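{- Let $q$ be a prime power, let $t$ be an even positive integer and let $r\geq 2$ be an integer. Then there exists a scattered $\mathbb{F}_q$-linear set of rank $\frac{rt}{2}$ in $PG(r-1,q^t)$ in each of the following cases: (1) $q=2$ and $t\geq 4$; (2) $q\geq 2$ arbitrary and $t\not\equiv 0 \pmod 3$; (3) $q\equiv 1 \pmod 3$ and $t\equiv 0\pmod 3$.
   Context: Let $V$ be an $r$-dimensional vector space over $\mathbb{F}_{q^t}$ and $PG(r-1,q^t)=PG(V,\mathbb{F}_{q^t})$ the associated projective space. For an $\mathbb{F}_q$-vector subspace $U$ of $V$ of $\mathbb{F}_q$-dimension $k$, the set $L_U=\{\langle u\rangle_{\mathbb{F}_{q^t}} : u\in U\setminus\{0\}\}$ is called an $\mathbb{F}_q$-linear set of rank $k$. The weight of a point $\langle v\rangle_{\mathbb{F}_{q^t}}$ in $L_U$ is $\dim_{\mathbb{F}_q}(U\cap\langle v\rangle_{\mathbb{F}_{q^t}})$. $L_U$ is scattered if every point of $L_U$ has weight $1$, equivalently $|L_U|=q^{k-1}+\dots+q+1$. -}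

module Defs where

open import Level using (0ℓ)
open import Data.Nat using (ℕ; _^_; _≥_)
open import Data.Nat.Primality using (Prime)
open import Data.Fin using (Fin; zero; suc)
open import Data.Product using (Σ; ∃; _×_; _,_)
open import Data.Sum using (_⊎_)
open import Relation.Nullary using (¬_)
open import Relation.Binary.PropositionalEquality as ≡ using (_≡_)
open import Function.Bundles using (Inverse)
open import Function.Definitions using (Injective)
open import Algebra.Bundles using (CommutativeRing)

IsPrimePower : ℕ → Set
IsPrimePower q = Σ ℕ λ p → Σ ℕ λ k → Prime p × k ≥ 1 × q ≡ p ^ k

-- A finite field F of order q^t together with its subfield K of order q.
-- F is a commutative ring (with setoid equality ≈) in which every nonzero
-- element is invertible and 0 ≉ 1, with exactly q^t elements (up to ≈).
-- K is the image of an injective map emb : Fin q → F, containing 0 and 1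
-- and closed under + and * (a finite subring of a field, hence a subfield).
record FieldExt (q t : ℕ) : Set₁ where
  field
    fieldRing : CommutativeRing 0ℓ 0ℓ
  open CommutativeRing fieldRing public
  field
    0≉1     : ¬ (0# ≈ 1#)
    inverse : ∀ x → ¬ (x ≈ 0#) → ∃ λ y → (x * y) ≈ 1#
    card    : Inverse (≡.setoid (Fin (q ^ t))) setoid
    emb     : Fin q → Carrier
    emb-inj : ∀ i j → emb i ≈ emb j → i ≡ j
    K-0     : ∃ λ i → emb i ≈ 0#
    K-1     : ∃ λ i → emb i ≈ 1#
    K-+     : ∀ i j → ∃ λ k → emb k ≈ (emb i + emb j)
    K-*     : ∀ i j → ∃ λ k → emb k ≈ (emb i * emb j)

module _ {q t : ℕ} (E : FieldExt q t) where
  open FieldExt E using (Carrier; _≈_; _+_; _*_; 0#; 1#; emb)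

  InK : Carrier → Set
  InK x = ∃ λ i → emb i ≈ x

  Vect : ℕ → Set
  Vect r = Fin r → Carrier

  _≈V_ : ∀ {r} → Vect r → Vect r → Set
  u ≈V v = ∀ j → u j ≈ v j

  zeroV : ∀ {r} → Vect r
  zeroV _ = 0#

  _·V_ : ∀ {r} → Carrier → Vect r → Vect r
  (λ' ·V v) j = λ' * v j

  lincomb : ∀ {k r} → (Fin k → Fin q) → (Fin k → Vect r) → Vect r
  lincomb {ℕ.zero}  c b j = 0#
  lincomb {ℕ.suc k} c b j = (emb (c zero) * b zero j) + lincomb (λ i → c (suc i)) (λ i → b (suc i)) j

  KIndependent : ∀ {k r} → (Fin k → Vect r) → Set
  KIndependent b = ∀ c → lincomb c b ≈V zeroV → ∀ i → emb (c i) ≈ 0#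

  InSpan : ∀ {k r} → (Fin k → Vect r) → Vect r → Set
  InSpan b v = ∃ λ c → lincomb c b ≈V v

  -- L_U is scattered: every point ⟨u⟩_F (u ∈ U∖{0}) has weight
  -- dim_K (U ∩ ⟨u⟩_F) = 1, i.e. U ∩ ⟨u⟩_F = ⟨u⟩_K, i.e. λu ∈ U ⇒ λ ∈ K.
  Scattered : ∀ {k r} → (Fin k → Vect r) → Set
  Scattered b = ∀ (u : Vect _) → InSpan b u → ¬ (u ≈V zeroV) →
                ∀ λ' → InSpan b (λ' ·V u) → InK λ'

  -- there is a scattered F_q-linear set of rank k in PG(r-1, q^t) = PG(F^r, F_{q^t}):
  -- an F_q-subspace U of F^r of F_q-dimension k (given by a K-basis) with L_U scattered
  ExistsScatteredLinearSet : ℕ → ℕ → Set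
  ExistsScatteredLinearSet r k =
    Σ (Fin k → Vect r) λ b → KIndependent b × Scattered b

module Submission where

-- Write F for the field with q^t elements, t = 2s, L for its subfield with q^s elements, and σ x = x^q.
-- The σ-graph {(x, σ x) : x ∈ F} is scattered of rank 2s in F², and direct sums of scattered subspaces are
-- scattered, so it remains to find a scattered subspace of rank 3s in F³.
-- The map w ↦ w σ(w) σ²(w) - σ²(w) of L sends 0 and 1 to 0, hence misses some value σ²(c); then the σ-semilinear
-- companion map f of the skew polynomial X³ - X - c on L³ has no eigenvector.  It has no invariant plane either:
-- rescaling f to g so that g acts on the quotient line as σ does, g^s - 1 is L-linear and not onto, so g^s fixes a
-- nonzero vector, and an average over the powers of g (nonzero by the independence of the σ^i) is an
-- eigenvector of f.  Hence x, f x, f² x are L-independent for x ≠ 0, which makes {ω x + f x : x ∈ L³} scattered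
-- for every ω ∈ F outside L.

open import Defs
open import Level using (0ℓ)
open import Algebra.Bundles using (CommutativeRing; Ring)
open import Algebra.Morphism.Structures using (IsRingMonomorphism)
import Algebra.Morphism.RingMonomorphism as RingMonomorphism
import Algebra.Properties.CommutativeMonoid.Sum as MonoidSum
import Algebra.Properties.CommutativeSemiring.Exp as Exp
import Algebra.Properties.Ring as RingProperties
import Algebra.Properties.Semiring.Mult.TCOptimised as Multiples
import Algebra.Solver.Ring as RingSolver
open import Algebra.Solver.Ring.AlmostCommutativeRing
  using (fromCommutativeRing; _-Raw-AlmostCommutative⟶_)
open import Data.Empty using (⊥)
open import Data.Fin as Fin using (Fin; zero; suc; combine; remQuot; finToFun; funToFin; inject≤)
open import Data.Fin.Patterns using (0F; 1F; 2F)
import Data.Fin.Properties as Fin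
open import Data.Integer as ℤ using (ℤ; -[1+_]; _⊖_; _◃_) renaming (+_ to pos)
import Data.Integer.Properties as ℤ
open import Data.Maybe using (Maybe; just; nothing)
open import Data.Nat as ℕ using (ℕ; zero; suc; _≤_; _<_; _≥_; s≤s; _%_) renaming (_^_ to _^ℕ_)
import Data.Nat.Properties as ℕ
open import Data.Product using (Σ; ∃; _×_; _,_; proj₁; proj₂; uncurry)
import Data.Sign as Sign
open import Data.Sum using (_⊎_; inj₁; inj₂)
open import Data.Unit using (⊤; tt)
open import Function using (_∘_; id)
open import Function.Bundles using (Inverse; mk↔ₛ′)
open import Relation.Binary using (Setoid; Decidable)
open import Relation.Binary.PropositionalEquality as ≡ using (_≡_; _≢_)
import Relation.Binary.Reasoning.Setoid as SetoidReasoning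
open import Relation.Nullary using (¬_; Dec; yes; no; contradiction)
open import Relation.Nullary.Decidable using (map′; ¬?; decidable-stable; _×-dec_)
open import Relation.Unary using () renaming (Decidable to Decidable₁)

-- An element of F has two coordinates over L, so multiplying `ω x + f x` by it and asking the
-- result to stay in the subspace gives a relation of degree at most two in `f`. This is why exactly
-- the invariant lines and planes of L³ must be excluded. The term -X of the skew polynomial
-- produces the collision at 0 and 1. For X³ - c the corresponding map is w ↦ w^(1+q+q²), which can
-- permute L, and then every choice of c leaves an eigenvector. For a plane, the rescaled map g acts
-- on the one-dimensional quotient as σ, whose s-th power is the identity on L. So g^s - 1 maps all
-- of L³ into the plane and, L³ being finite, cannot be injective. The sum of g^i (l z) over i < s
-- is the device of Hilbert 90: it is fixed by g for every l, and the freedom in l makes it nonzero.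
-- Dimension arguments appear as counts: injective self-maps of finite sets are onto, and a degree
-- bounds the number of roots. The order of L itself comes from counting the kernel and the image of
-- x ↦ σ^s x - x.

cast-injective : ∀ {m n} (eq : m ≡ n) {i j : Fin m} → Fin.cast eq i ≡ Fin.cast eq j → i ≡ j
cast-injective eq {i} {j} e = Fin.toℕ-injective
  (≡.trans (≡.sym (Fin.toℕ-cast eq i)) (≡.trans (≡.cong Fin.toℕ e) (Fin.toℕ-cast eq j)))

-- Counting on finite sets and finite setoids

injective⇒surjective : ∀ {n} {f : Fin n → Fin n} → (∀ {i j} → f i ≡ f j → i ≡ j) →
                       ∀ j → ∃ λ i → f i ≡ j
injective⇒surjective {suc n} {f} inj j with Fin.any? (λ i → f i Fin.≟ j)
... | yes hit = hit
... | no miss = contradiction (Fin.injective⇒≤ {f = g} g-inj) (ℕ.<⇒≱ ℕ.≤-refl)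
  where
  avoid : ∀ i → j ≢ f i
  avoid i e = miss (i , ≡.sym e)
  g : Fin (suc n) → Fin n
  g i = Fin.punchOut (avoid i)
  g-inj : ∀ {i k} → g i ≡ g k → i ≡ k
  g-inj {i} {k} e = inj (Fin.punchOut-injective (avoid i) (avoid k) e)

enumerateSubset : ∀ {n} {P : Fin n → Set} → Decidable₁ P →
  Σ ℕ λ m → Σ (Fin m → Fin n) λ e →
    (∀ {i j} → e i ≡ e j → i ≡ j) × (∀ i → P (e i)) × (∀ j → P j → ∃ λ i → e i ≡ j)
enumerateSubset {zero} P? = 0 , (λ ()) , (λ { {()} }) , (λ ()) , (λ ())
enumerateSubset {suc n} {P} P? with enumerateSubset (P? ∘ suc) | P? zero
... | m , e , inj , mem , cover | no ¬p =
  m , suc ∘ e , inj ∘ Fin.suc-injective , mem ,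
  λ { zero p → contradiction p ¬p
    ; (suc j) p → proj₁ (cover j p) , ≡.cong suc (proj₂ (cover j p)) }
... | m , e , inj , mem , cover | yes p₀ = suc m , e′ , (λ {i} {j} → inj′ i j) , mem′ , cover′
  where
  e′ : Fin (suc m) → Fin (suc n)
  e′ zero = zero
  e′ (suc i) = suc (e i)
  inj′ : ∀ i j → e′ i ≡ e′ j → i ≡ j
  inj′ zero zero _ = ≡.refl
  inj′ (suc i) (suc j) eq = ≡.cong suc (inj (Fin.suc-injective eq))
  mem′ : ∀ i → P (e′ i)
  mem′ zero = p₀
  mem′ (suc i) = mem i
  cover′ : ∀ j → P j → ∃ λ i → e′ i ≡ j
  cover′ zero _ = zero , ≡.refl
  cover′ (suc j) p = suc (proj₁ (cover j p)) , ≡.cong suc (proj₂ (cover j p))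

-- Compatibility of `index` with the equality follows from `at-injective`, so the two laws describe
-- a bijection with the setoid. The record is instantiated with field elements and with vectors.
record Enumeration (N : ℕ) (S : Setoid 0ℓ 0ℓ) : Set where
  open Setoid S
  field
    at           : Fin N → Carrier
    index        : Carrier → Fin N
    at-index     : ∀ x → at (index x) ≈ x
    at-injective : ∀ {i j} → at i ≈ at j → i ≡ j

  index-injective : ∀ {x y} → index x ≡ index y → x ≈ y
  index-injective {x} {y} e = trans (sym (at-index x)) (trans (reflexive (≡.cong at e)) (at-index y))

  index-cong : ∀ {x y} → x ≈ y → index x ≡ index y
  index-cong {x} {y} e = at-injective (trans (at-index x) (trans e (sym (at-index y))))

  infix 4 _≟_
  _≟_ : Decidable _≈_
  x ≟ y = map′ index-injective index-cong (index x Fin.≟ index y)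

  any? : {P : Carrier → Set} → (∀ {x y} → x ≈ y → P x → P y) → Decidable₁ P → Dec (∃ P)
  any? resp P? = map′ (λ { (i , p) → at i , p }) (λ { (x , p) → index x , resp (sym (at-index x)) p })
                      (Fin.any? (P? ∘ at))

  injective⇒surjective′ : {f : Carrier → Carrier} → (∀ {x y} → f x ≈ f y → x ≈ y) →
                          ∀ y → ∃ λ x → f x ≈ y
  injective⇒surjective′ {f} inj y =
    let i , e = injective⇒surjective {f = index ∘ f ∘ at} (at-injective ∘ inj ∘ index-injective) (index y)
    in at i , index-injective e

  -- Pigeonhole: if every value were attained, choosing preimages would give an injective, hence
  -- surjective, `section`. Then `x` and `y` would both be the chosen preimage of one and the same
  -- value, and so coincide.
  collision⇒missed : {f : Carrier → Carrier} → (∀ {x y} → x ≈ y → f x ≈ f y) →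
                     ∀ {x y} → f x ≈ f y → ¬ x ≈ y → ∃ λ c → ∀ u → ¬ f u ≈ c
  collision⇒missed {f} f-cong {x} {y} fx≈fy x≉y =
    let i , ¬hit = Fin.¬∀⟶∃¬ N _ (λ i → Fin.any? λ j → f (at j) ≟ at i) notAllHit
    in at i , λ u e → ¬hit (index u , trans (f-cong (at-index u)) e)
    where
    notAllHit : ¬ (∀ i → ∃ λ j → f (at j) ≈ at i)
    notAllHit hit = x≉y (index-injective (begin
      index x          ≡⟨ proj₂ (preimage x) ⟨
      section (proj₁ (preimage x))  ≡⟨ ≡.cong section (at-injective same) ⟩
      section (proj₁ (preimage y))  ≡⟨ proj₂ (preimage y) ⟩
      index y          ∎))
      where
      open ≡.≡-Reasoning
      section : Fin N → Fin N
      section = proj₁ ∘ hit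
      preimage : ∀ z → ∃ λ i → section i ≡ index z
      preimage z = injective⇒surjective {f = section}
        (λ {i} {j} e → at-injective (trans (sym (proj₂ (hit i)))
          (trans (reflexive (≡.cong (f ∘ at) e)) (proj₂ (hit j))))) (index z)
      image : ∀ z → at (proj₁ (preimage z)) ≈ f z
      image z = trans (sym (proj₂ (hit _)))
        (f-cong (trans (reflexive (≡.cong at (proj₂ (preimage z)))) (at-index z)))
      same : at (proj₁ (preimage x)) ≈ at (proj₁ (preimage y))
      same = trans (image x) (trans fx≈fy (sym (image y)))

-- Ring identities with integer coefficients

module IntegerCoefficientSolver (R : CommutativeRing 0ℓ 0ℓ) where
  open CommutativeRing R renaming (_*_ to _·_) hiding (zero)
  open RingProperties ring
  open Multiples semiring using (×1-homo-*; 1+×) renaming (_×_ to _⊠_; ×-homo-+ to ⊠-homo-+)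
  open SetoidReasoning setoid

  -- These multiples satisfy `1 ⊠ x = x` by computation, so `con (pos 1)` stands for `1#` itself in
  -- the goals to be solved.
  fromℤ : ℤ → Carrier
  fromℤ (pos n)  = n ⊠ 1#
  fromℤ -[1+ n ] = - (suc n ⊠ 1#)

  private
    cancel-shift : ∀ z x y → (z + x) - (z + y) ≈ x - y
    cancel-shift z x y = begin
      (z + x) - (z + y)      ≈⟨ +-cong (+-comm z x) (sym (-‿+-comm z y)) ⟩
      (x + z) + (- z + - y)  ≈⟨ +-assoc x z _ ⟩
      x + (z + (- z + - y))  ≈⟨ +-congˡ (sym (+-assoc z (- z) (- y))) ⟩
      x + ((z - z) + - y)    ≈⟨ +-congˡ (+-congʳ (-‿inverseʳ z)) ⟩
      x + (0# + - y)         ≈⟨ +-congˡ (+-identityˡ _) ⟩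
      x - y                  ∎

    fromℤ-⊖ : ∀ m n → fromℤ (m ⊖ n) ≈ m ⊠ 1# - n ⊠ 1#
    fromℤ-⊖ m zero = sym (trans (+-congˡ -0#≈0#) (+-identityʳ _))
    fromℤ-⊖ zero (suc n) = sym (+-identityˡ _)
    fromℤ-⊖ (suc m) (suc n) = begin
      fromℤ (suc m ⊖ suc n)      ≡⟨ ≡.cong fromℤ (ℤ.[1+m]⊖[1+n]≡m⊖n m n) ⟩
      fromℤ (m ⊖ n)              ≈⟨ fromℤ-⊖ m n ⟩
      m ⊠ 1# - n ⊠ 1#            ≈⟨ trans (+-cong (1+× m 1#) (-‿cong (1+× n 1#))) (cancel-shift 1# _ _) ⟨
      suc m ⊠ 1# - suc n ⊠ 1#    ∎

    fromℤ-neg : ∀ i → fromℤ (ℤ.- i) ≈ - fromℤ i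
    fromℤ-neg (pos zero)    = sym -0#≈0#
    fromℤ-neg (pos (suc n)) = refl
    fromℤ-neg -[1+ n ]      = sym (-‿involutive _)

    fromℤ-+ : ∀ i j → fromℤ (i ℤ.+ j) ≈ fromℤ i + fromℤ j
    fromℤ-+ (pos m) (pos n) = ⊠-homo-+ 1# m n
    fromℤ-+ (pos m) -[1+ n ] = fromℤ-⊖ m (suc n)
    fromℤ-+ -[1+ m ] (pos n) = trans (fromℤ-⊖ n (suc m)) (+-comm _ _)
    fromℤ-+ -[1+ m ] -[1+ n ] = begin
      - (suc (suc (m ℕ.+ n)) ⊠ 1#)         ≡⟨ ≡.cong (λ k → - (suc k ⊠ 1#)) (ℕ.+-suc m n) ⟨
      - ((suc m ℕ.+ suc n) ⊠ 1#)           ≈⟨ -‿cong (⊠-homo-+ 1# (suc m) (suc n)) ⟩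
      - (suc m ⊠ 1# + suc n ⊠ 1#)          ≈⟨ -‿+-comm _ _ ⟨
      - (suc m ⊠ 1#) + - (suc n ⊠ 1#)      ∎

    fromℤ-◃ : ∀ n → fromℤ (Sign.- ◃ n) ≈ - (n ⊠ 1#)
    fromℤ-◃ n = trans (reflexive (≡.cong fromℤ (ℤ.-◃n≡-n n))) (fromℤ-neg (pos n))

    fromℤ-* : ∀ i j → fromℤ (i ℤ.* j) ≈ fromℤ i · fromℤ j
    fromℤ-* (pos m) (pos n) =
      trans (reflexive (≡.cong fromℤ (ℤ.+◃n≡+n (m ℕ.* n)))) (×1-homo-* m n)
    fromℤ-* (pos m) -[1+ n ] =
      trans (fromℤ-◃ (m ℕ.* suc n)) (trans (-‿cong (×1-homo-* m (suc n))) (-‿distribʳ-* _ _))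
    fromℤ-* -[1+ m ] (pos n) =
      trans (fromℤ-◃ (suc m ℕ.* n)) (trans (-‿cong (×1-homo-* (suc m) n)) (-‿distribˡ-* _ _))
    fromℤ-* -[1+ m ] -[1+ n ] = begin
      (suc m ℕ.* suc n) ⊠ 1#                 ≈⟨ ×1-homo-* (suc m) (suc n) ⟩
      (suc m ⊠ 1#) · (suc n ⊠ 1#)          ≈⟨ -‿involutive _ ⟨
      - - ((suc m ⊠ 1#) · (suc n ⊠ 1#))    ≈⟨ -‿cong (-‿distribʳ-* _ _) ⟩
      - ((suc m ⊠ 1#) · - (suc n ⊠ 1#))    ≈⟨ -‿distribˡ-* _ _ ⟩
      - (suc m ⊠ 1#) · - (suc n ⊠ 1#)      ∎

    morphism : CommutativeRing.rawRing ℤ.+-*-commutativeRing -Raw-AlmostCommutative⟶ fromCommutativeRing R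
    morphism = record
      { ⟦_⟧ = fromℤ ; +-homo = fromℤ-+ ; *-homo = fromℤ-* ; -‿homo = fromℤ-neg
      ; 0-homo = refl ; 1-homo = refl }

    weakEquality : ∀ i j → Maybe (fromℤ i ≈ fromℤ j)
    weakEquality i j with i ℤ.≟ j
    ... | yes e = just (reflexive (≡.cong fromℤ e))
    ... | no _  = nothing

  open RingSolver _ _ morphism weakEquality public
    using (solve; con; _:+_; _:*_; _:-_; :-_; _:=_)

-- Polynomial functions on a finite field and their roots

module FiniteField {q n : ℕ} (E : FieldExt q n) where
  open FieldExt E public hiding (zero)
  open RingProperties ring public
  open Exp commutativeSemiring public
  open IntegerCoefficientSolver fieldRing public using (solve; con; _:+_; _:*_; _:-_; :-_; _:=_)
  open SetoidReasoning setoid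

  enumeration : Enumeration (q ℕ.^ n) setoid
  enumeration = record
    { at = to ; index = from ; at-index = λ _ → inverseˡ ≡.refl
    ; at-injective = λ {i} {j} e → ≡.trans (≡.sym (inverseʳ refl)) (inverseʳ e) }
    where open Inverse card
  open Enumeration enumeration public

  x≈y⇒x-y≈0 : ∀ {x y} → x ≈ y → x - y ≈ 0#
  x≈y⇒x-y≈0 {x} {y} e = trans (+-congʳ e) (-‿inverseʳ y)

  x-y≈0⇒x≈y : ∀ {x y} → x - y ≈ 0# → x ≈ y
  x-y≈0⇒x≈y {x} {y} e = begin
    x            ≈⟨ solve 2 (λ x y → x := (x :- y) :+ y) refl x y ⟩
    (x - y) + y  ≈⟨ +-congʳ e ⟩
    0# + y       ≈⟨ +-identityˡ y ⟩
    y            ∎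

  noZeroDivisors : ∀ {x y} → x * y ≈ 0# → ¬ x ≈ 0# → y ≈ 0#
  noZeroDivisors {x} {y} xy≈0 x≉0 with inverse x x≉0
  ... | x⁻¹ , xx⁻¹≈1 = begin
    y                ≈⟨ *-identityˡ y ⟨
    1# * y           ≈⟨ *-congʳ xx⁻¹≈1 ⟨
    (x * x⁻¹) * y    ≈⟨ solve 3 (λ x i y → (x :* i) :* y := i :* (x :* y)) refl x x⁻¹ y ⟩
    x⁻¹ * (x * y)    ≈⟨ *-congˡ xy≈0 ⟩
    x⁻¹ * 0#         ≈⟨ zeroʳ x⁻¹ ⟩
    0#               ∎

  xz≈yz⇒z≈0 : ∀ {x y z} → x * z ≈ y * z → ¬ x ≈ y → z ≈ 0#
  xz≈yz⇒z≈0 {x} {y} {z} e x≉y = noZeroDivisors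
    (trans ([y-z]x≈yx-zx z x y) (x≈y⇒x-y≈0 e)) (x≉y ∘ x-y≈0⇒x≈y)

  *-cancelˡ : ∀ {x y z} → ¬ x ≈ 0# → x * y ≈ x * z → y ≈ z
  *-cancelˡ {x} {y} {z} x≉0 e =
    x-y≈0⇒x≈y (noZeroDivisors (trans (x[y-z]≈xy-xz x y z) (x≈y⇒x-y≈0 e)) x≉0)

  -- Poly c d f: f is a polynomial function of degree at most d whose coefficient at x^d is c.
  -- The recursion is the factor theorem f x - f a = (x - a) g x, without subtraction.
  Poly : Carrier → ℕ → (Carrier → Carrier) → Set
  Poly c zero f    = ∀ x → f x ≈ c
  Poly c (suc d) f = ∀ a → ∃ λ g → Poly c d g × (∀ x → f x + a * g x ≈ f a + x * g x)

  poly-cong : ∀ {c c′} d {f f′} → c ≈ c′ → (∀ x → f x ≈ f′ x) → Poly c d f → Poly c′ d f′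
  poly-cong zero ec ef P x = trans (sym (ef x)) (trans (P x) ec)
  poly-cong (suc d) ec ef P a with P a
  ... | g , Pg , eq = g , poly-cong d ec (λ _ → refl) Pg ,
    λ x → trans (+-congʳ (sym (ef x))) (trans (eq x) (+-congʳ (ef a)))

  poly-+ : ∀ {c c′} d {f f′} → Poly c d f → Poly c′ d f′ → Poly (c + c′) d (λ x → f x + f′ x)
  poly-+ zero P P′ x = +-cong (P x) (P′ x)
  poly-+ (suc d) {f} {f′} P P′ a with P a | P′ a
  ... | g , Pg , eq | g′ , Pg′ , eq′ = (λ x → g x + g′ x) , poly-+ d Pg Pg′ , λ x → begin
    f x + f′ x + a * (g x + g′ x)
      ≈⟨ solve 5 (λ f f′ a g g′ → f :+ f′ :+ a :* (g :+ g′) := (f :+ a :* g) :+ (f′ :+ a :* g′))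
               refl (f x) (f′ x) a (g x) (g′ x) ⟩
    (f x + a * g x) + (f′ x + a * g′ x)  ≈⟨ +-cong (eq x) (eq′ x) ⟩
    (f a + x * g x) + (f′ a + x * g′ x)
      ≈⟨ solve 5 (λ f f′ a g g′ → (f :+ a :* g) :+ (f′ :+ a :* g′) := f :+ f′ :+ a :* (g :+ g′))
               refl (f a) (f′ a) x (g x) (g′ x) ⟩
    f a + f′ a + x * (g x + g′ x)  ∎

  poly-scale : ∀ {c} d b {f} → Poly c d f → Poly (b * c) d (λ x → b * f x)
  poly-scale zero b P x = *-congˡ (P x)
  poly-scale (suc d) b {f} P a with P a
  ... | g , Pg , eq = (λ x → b * g x) , poly-scale d b Pg , λ x → begin
    b * f x + a * (b * g x)
      ≈⟨ solve 4 (λ b f a g → b :* f :+ a :* (b :* g) := b :* (f :+ a :* g)) refl b (f x) a (g x) ⟩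
    b * (f x + a * g x)  ≈⟨ *-congˡ (eq x) ⟩
    b * (f a + x * g x)
      ≈⟨ solve 4 (λ b f a g → b :* (f :+ a :* g) := b :* f :+ a :* (b :* g)) refl b (f a) x (g x) ⟩
    b * f a + x * (b * g x)  ∎

  poly-raise : ∀ {c} d {f} → Poly c d f → Poly 0# (suc d) f
  poly-raise zero P a = (λ _ → 0#) , (λ _ → refl) ,
    λ x → +-cong (trans (P x) (sym (P a))) (trans (zeroʳ a) (sym (zeroʳ x)))
  poly-raise (suc d) P a with P a
  ... | g , Pg , eq = g , poly-raise d Pg , eq

  poly-< : ∀ {c d e f} → d < e → Poly c d f → Poly 0# e f
  poly-< {d = d} {f = f} d<e P = go (ℕ.≤⇒≤′ d<e)
    where
    go : ∀ {e} → suc d ℕ.≤′ e → Poly 0# e f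
    go ℕ.≤′-refl = poly-raise d P
    go (ℕ.≤′-step {m} h) = poly-raise m (go h)

  poly-shift : ∀ {c} d b {f} → Poly c d f → Poly c (suc d) (λ x → (x + b) * f x)
  poly-shift {c} zero b {f} P a = (λ _ → c) , (λ _ → refl) , λ x → begin
    (x + b) * f x + a * c  ≈⟨ +-congʳ (*-congˡ (P x)) ⟩
    (x + b) * c + a * c
      ≈⟨ solve 4 (λ x b c a → (x :+ b) :* c :+ a :* c := (a :+ b) :* c :+ x :* c) refl x b c a ⟩
    (a + b) * c + x * c    ≈⟨ +-congʳ (*-congˡ (P a)) ⟨
    (a + b) * f a + x * c  ∎
  poly-shift {c} (suc d) b {f} P a with P a
  -- (x + b) f x - (a + b) f a = (x - a) f x + (a + b) (f x - f a), and the last difference is (x -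
  -- a) g x.
  ... | g , Pg , eq = (λ x → f x + (a + b) * g x) ,
    poly-cong (suc d) (+-identityʳ c) (λ _ → refl)
      (poly-+ (suc d) P (poly-raise d (poly-scale d (a + b) Pg))) , λ x → begin
    (x + b) * f x + a * (f x + (a + b) * g x)
      ≈⟨ solve 5 (λ x b f a g → (x :+ b) :* f :+ a :* (f :+ (a :+ b) :* g)
                             := x :* f :+ (a :+ b) :* (f :+ a :* g)) refl x b (f x) a (g x) ⟩
    x * f x + (a + b) * (f x + a * g x)  ≈⟨ +-congˡ (*-congˡ (eq x)) ⟩
    x * f x + (a + b) * (f a + x * g x)
      ≈⟨ solve 6 (λ x b f a g fa → x :* f :+ (a :+ b) :* (fa :+ x :* g)
                             := (a :+ b) :* fa :+ x :* (f :+ (a :+ b) :* g)) refl x b (f x) a (g x) (f a) ⟩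
    (a + b) * f a + x * (f x + (a + b) * g x)  ∎

  poly-const : ∀ c → Poly c 0 (λ _ → c)
  poly-const c _ = refl

  poly-^ : ∀ d → Poly 1# d (_^ d)
  poly-^ zero _  = refl
  poly-^ (suc d) = poly-cong (suc d) refl (λ x → *-congʳ (+-identityʳ x)) (poly-shift d 0# (poly-^ d))

  -- Divide by x - r₀: the quotient has degree one less and vanishes at the remaining roots, since
  -- r₀ differs from them. The statement on `c` bounds numbers of roots; the statement on `f` proves
  -- identities between functions, such as the additivity of σ.
  vanishing : ∀ {c} d {f} → Poly c d f → (r : Fin (suc d) → Carrier) →
              (∀ {i j} → r i ≈ r j → i ≡ j) → (∀ i → f (r i) ≈ 0#) → c ≈ 0# × (∀ x → f x ≈ 0#)
  vanishing zero P r inj root = c≈0 , λ x → trans (P x) c≈0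
    where c≈0 = trans (sym (P (r zero))) (root zero)
  vanishing (suc d) {f} P r inj root = proj₁ rest , λ x → begin
    f x                     ≈⟨ +-identityʳ _ ⟨
    f x + 0#                ≈⟨ +-congˡ (trans (*-congˡ (proj₂ rest x)) (zeroʳ _)) ⟨
    f x + r zero * g x      ≈⟨ eq x ⟩
    f (r zero) + x * g x    ≈⟨ +-cong (root zero) (trans (*-congˡ (proj₂ rest x)) (zeroʳ x)) ⟩
    0# + 0#                 ≈⟨ +-identityˡ 0# ⟩
    0#                      ∎
    where
    g  = proj₁ (P (r zero))
    eq = proj₂ (proj₂ (P (r zero)))
    g-root : ∀ i → g (r (suc i)) ≈ 0#
    g-root i = xz≈yz⇒z≈0 (begin
      r zero * g y         ≈⟨ +-identityˡ _ ⟨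
      0# + r zero * g y    ≈⟨ +-congʳ (root (suc i)) ⟨
      f y + r zero * g y   ≈⟨ eq y ⟩
      f (r zero) + y * g y ≈⟨ +-congʳ (root zero) ⟩
      0# + y * g y         ≈⟨ +-identityˡ _ ⟩
      y * g y              ∎)
      (λ e → contradiction (inj e) (λ ()))
      where y = r (suc i)
    rest = vanishing d (proj₁ (proj₂ (P (r zero)))) (r ∘ suc) (λ e → Fin.suc-injective (inj e)) g-root

  manyRoots⇒leading≈0 : ∀ {c d f N} → Poly c d f → d < N → (r : Fin N → Carrier) →
                        (∀ {i j} → r i ≈ r j → i ≡ j) → (∀ i → f (r i) ≈ 0#) → c ≈ 0#
  manyRoots⇒leading≈0 {d = d} P d<N r inj root = proj₁ (vanishing d P (r ∘ λ i → inject≤ i d<N)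
    (λ e → Fin.inject≤-injective d<N d<N _ _ (inj e)) (λ i → root _))

  monicRoots≤degree : ∀ {d f N} → Poly 1# d f → (r : Fin N → Carrier) →
                      (∀ {i j} → r i ≈ r j → i ≡ j) → (∀ i → f (r i) ≈ 0#) → N ≤ d
  monicRoots≤degree P r inj root =
    ℕ.≮⇒≥ λ d<N → 0≉1 (sym (manyRoots⇒leading≈0 P d<N r inj root))

  -- Fermat's theorem for finite multiplicatively closed sets

  module Product = MonoidSum *-commutativeMonoid

  product≉0 : ∀ {N} (t : Fin N → Carrier) → (∀ i → ¬ t i ≈ 0#) → ¬ Product.sum t ≈ 0#
  product≉0 {zero} t t≉0 e = 0≉1 (sym e)
  product≉0 {suc N} t t≉0 e = product≉0 (t ∘ suc) (t≉0 ∘ suc) (noZeroDivisors e (t≉0 zero))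

  -- Fermat: multiplication by x permutes the nonzero elements, so x^(N-1) leaves their product unchanged.
  fermat : ∀ {N} (e : Fin N → Carrier) → (∀ {i j} → e i ≈ e j → i ≡ j) →
           (∀ i j → ∃ λ k → e k ≈ e i * e j) → (∃ λ i → e i ≈ 0#) → ∀ i → e i ^ N ≈ e i
  fermat {suc m} e inj mul (z , ez≈0) i with e i ≟ 0#
  ... | yes x≈0 = begin
    e i * e i ^ m  ≈⟨ *-congʳ x≈0 ⟩
    0# * e i ^ m   ≈⟨ zeroˡ _ ⟩
    0#             ≈⟨ x≈0 ⟨
    e i            ∎
  ... | no x≉0 = begin
    x * x ^ m    ≈⟨ *-congˡ x^m≈1 ⟩
    x * 1#       ≈⟨ *-identityʳ x ⟩
    x            ∎
    where
    x = e i
    times : Fin (suc m) → Fin (suc m)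
    times j = proj₁ (mul i j)
    times-inj : ∀ {j k} → times j ≡ times k → j ≡ k
    times-inj {j} {k} eq = inj (*-cancelˡ x≉0 (begin
      x * e j      ≈⟨ proj₂ (mul i j) ⟨
      e (times j)  ≡⟨ ≡.cong e eq ⟩
      e (times k)  ≈⟨ proj₂ (mul i k) ⟩
      x * e k      ∎))
    times-surj = injective⇒surjective times-inj
    π = mk↔ₛ′ times (proj₁ ∘ times-surj) (proj₂ ∘ times-surj)
              (λ j → times-inj (proj₂ (times-surj (times j))))
    -- The slot `z` of the zero element holds 1 in both families. Products can thus run over all of
    -- `Fin (suc m)`, with `times` as the permutation, and `factor` contributes x exactly m times.
    unit factor : Fin (suc m) → Carrier
    unit j with j Fin.≟ z
    ... | yes _ = 1#
    ... | no _  = e j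
    factor j with j Fin.≟ z
    ... | yes _ = 1#
    ... | no _  = x
    unit≉0 : ∀ j → ¬ unit j ≈ 0#
    unit≉0 j with j Fin.≟ z
    ... | yes _  = 0≉1 ∘ sym
    ... | no j≢z = λ ej≈0 → j≢z (inj (trans ej≈0 (sym ez≈0)))
    unit-times : ∀ j → unit (times j) ≈ factor j * unit j
    unit-times j with times j Fin.≟ z | j Fin.≟ z
    ... | yes _ | yes _ = sym (*-identityˡ 1#)
    ... | no _  | no _  = proj₂ (mul i j)
    ... | yes p | no j≢z = contradiction (inj (trans ej≈0 (sym ez≈0))) j≢z
      where
      ej≈0 : e j ≈ 0#
      ej≈0 = noZeroDivisors (trans (sym (proj₂ (mul i j))) (trans (reflexive (≡.cong e p)) ez≈0)) x≉0
    ... | no ne | yes p = contradiction (inj (begin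
      e (times j)  ≈⟨ proj₂ (mul i j) ⟩
      x * e j      ≡⟨ ≡.cong (λ k → x * e k) p ⟩
      x * e z      ≈⟨ *-congˡ ez≈0 ⟩
      x * 0#       ≈⟨ zeroʳ x ⟩
      0#           ≈⟨ ez≈0 ⟨
      e z          ∎)) ne
    ∏unit = Product.sum unit
    ∏factor = Product.sum factor
    ∏factor≈1 : ∏factor ≈ 1#
    ∏factor≈1 = *-cancelˡ (product≉0 unit unit≉0) (begin
      ∏unit * ∏factor                             ≈⟨ *-comm _ _ ⟩
      ∏factor * ∏unit                             ≈⟨ Product.∑-distrib-+ factor unit ⟨
      Product.sum (λ j → factor j * unit j)       ≈⟨ Product.sum-cong-≋ (sym ∘ unit-times) ⟩
      Product.sum (unit ∘ times)                  ≈⟨ Product.sum-permute unit π ⟨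
      ∏unit                                       ≈⟨ *-identityʳ _ ⟨
      ∏unit * 1#                                  ∎)
    factor-z : factor z ≈ 1#
    factor-z with z Fin.≟ z
    ... | yes _ = refl
    ... | no ne = contradiction ≡.refl ne
    factor-≢z : ∀ j → factor (Fin.punchIn z j) ≈ x
    factor-≢z j with Fin.punchIn z j Fin.≟ z
    ... | yes p = contradiction p (Fin.punchInᵢ≢i z j)
    ... | no _  = refl
    x^m≈1 : x ^ m ≈ 1#
    x^m≈1 = begin
      x ^ m                                                ≈⟨ Product.sum-replicate m ⟨
      Product.sum {m} (λ _ → x)                            ≈⟨ Product.sum-cong-≋ factor-≢z ⟨
      Product.sum (factor ∘ Fin.punchIn z)                 ≈⟨ *-identityˡ _ ⟨
      1# * Product.sum (factor ∘ Fin.punchIn z)            ≈⟨ *-congʳ factor-z ⟨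
      factor z * Product.sum (factor ∘ Fin.punchIn z)      ≈⟨ Product.sum-remove {i = z} factor ⟨
      ∏factor                                              ≈⟨ ∏factor≈1 ⟩
      1#                                                   ∎

  private
    z₀ : Fin q
    z₀ = proj₁ K-0

    ez₀≈0 : emb z₀ ≈ 0#
    ez₀≈0 = proj₂ K-0

  emb-injective : ∀ {i j} → emb i ≈ emb j → i ≡ j
  emb-injective = emb-inj _ _

  1<q : 1 < q
  1<q = Fin.injective⇒≤ {f = pick} pick-inj
    where
    z≢o : z₀ ≢ proj₁ K-1
    z≢o e = 0≉1 (trans (sym ez₀≈0) (trans (reflexive (≡.cong emb e)) (proj₂ K-1)))
    pick : Fin 2 → Fin q
    pick 0F = z₀
    pick 1F = proj₁ K-1
    pick-inj : ∀ {i j} → pick i ≡ pick j → i ≡ j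
    pick-inj {0F} {0F} _ = ≡.refl
    pick-inj {0F} {1F} e = contradiction e z≢o
    pick-inj {1F} {0F} e = contradiction (≡.sym e) z≢o
    pick-inj {1F} {1F} _ = ≡.refl

  instance
    q-nonZero : ℕ.NonZero q
    q-nonZero = ℕ.>-nonZero (ℕ.<-trans ℕ.0<1+n 1<q)

  -- The Frobenius map σ and its fixed field K

  σ : Carrier → Carrier
  σ x = x ^ q

  σ-emb : ∀ i → σ (emb i) ≈ emb i
  σ-emb = fermat emb emb-injective K-* K-0

  σ-cong : ∀ {x y} → x ≈ y → σ x ≈ σ y
  σ-cong = ^-congˡ q

  σ-* : ∀ x y → σ (x * y) ≈ σ x * σ y
  σ-* x y = ^-distrib-* x y q

  σ-1 : σ 1# ≈ 1#
  σ-1 = trans (sym (σ-cong (proj₂ K-1))) (trans (σ-emb _) (proj₂ K-1))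

  σ-0 : σ 0# ≈ 0#
  σ-0 = trans (sym (σ-cong ez₀≈0)) (trans (σ-emb _) ez₀≈0)

  -- A binomial expansion without binomial coefficients: the additivity of σ only uses that the
  -- remainder has degree below the exponent.
  ^-shift : ∀ y d → ∃ λ c → Σ (Carrier → Carrier) λ r → Poly c d r ×
            (∀ x → (x + y) ^ suc d ≈ x ^ suc d + r x)
  ^-shift y zero = y , (λ _ → y) , poly-const y ,
    λ x → solve 2 (λ x y → (x :+ y) :* con (pos 1) := x :* con (pos 1) :+ y) refl x y
  ^-shift y (suc d) with ^-shift y d
  ... | c , r , Pr , eq = y * 1# + c , (λ x → y * x ^ suc d + (x + y) * r x) ,
    poly-+ (suc d) (poly-scale (suc d) y (poly-^ (suc d))) (poly-shift d y Pr) , λ x → begin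
      (x + y) * (x + y) ^ suc d        ≈⟨ *-congˡ (eq x) ⟩
      (x + y) * (x ^ suc d + r x)
        ≈⟨ solve 4 (λ x y p r → (x :+ y) :* (p :+ r) := x :* p :+ (y :* p :+ (x :+ y) :* r))
                 refl x y (x ^ suc d) (r x) ⟩
      x * x ^ suc d + (y * x ^ suc d + (x + y) * r x)  ∎

  -- (x + y)^q - x^q is a polynomial in x of degree less than q which takes the value y^q at the q points of Ky.
  σ-+ : ∀ x y → σ (x + y) ≈ σ x + σ y
  σ-+ x y with y ≟ 0#
  ... | yes y≈0 = begin
    σ (x + y)   ≈⟨ σ-cong (trans (+-congˡ y≈0) (+-identityʳ x)) ⟩
    σ x         ≈⟨ +-identityʳ _ ⟨
    σ x + 0#    ≈⟨ +-congˡ (trans (σ-cong y≈0) σ-0) ⟨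
    σ x + σ y   ∎
  ... | no y≉0 = helper q ≡.refl
    where
    shifted-K : ∀ i → σ (emb i * y + y) ≈ σ (emb i * y) + σ y
    shifted-K i = begin
      σ (emb i * y + y)        ≈⟨ σ-cong (trans (+-congˡ (sym (*-identityˡ y))) (sym (distribʳ y (emb i) 1#))) ⟩
      σ ((emb i + 1#) * y)     ≈⟨ σ-* _ y ⟩
      σ (emb i + 1#) * σ y     ≈⟨ *-congʳ (σ-cong emb-k) ⟨
      σ (emb k) * σ y          ≈⟨ *-congʳ (trans (σ-emb k) emb-k) ⟩
      (emb i + 1#) * σ y       ≈⟨ trans (distribʳ _ _ _) (+-congˡ (*-identityˡ _)) ⟩
      emb i * σ y + σ y        ≈⟨ +-congʳ (*-congʳ (σ-emb i)) ⟨
      σ (emb i) * σ y + σ y    ≈⟨ +-congʳ (σ-* (emb i) y) ⟨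
      σ (emb i * y) + σ y      ∎
      where
      k = proj₁ (K-+ i (proj₁ K-1))
      emb-k : emb k ≈ emb i + 1#
      emb-k = trans (proj₂ (K-+ i (proj₁ K-1))) (+-congˡ (proj₂ K-1))
    -- Writing q as m + 2 shows that the remainder has degree bound m + 1 = q - 1, that the constant
    -- σ y can be raised to this bound, and that the q points of Ky are one more than it.
    helper : ∀ m → q ≡ m → σ (x + y) ≈ σ x + σ y
    helper 0 e = contradiction (≡.subst (1 <_) e 1<q) λ ()
    helper 1 e = contradiction (≡.subst (1 <_) e 1<q) (ℕ.<-irrefl ≡.refl)
    helper (suc (suc m)) ≡.refl with ^-shift y (suc m)
    ... | c , r , Pr , eq = trans (eq x) (+-congˡ (x-y≈0⇒x≈y (proj₂ (vanishing (suc m) difference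
              (λ i → emb i * y) (λ {i} {j} → ky-inj i j) root) x)))
      where
      difference : Poly (c + 0#) (suc m) (λ x → r x - σ y)
      difference = poly-+ (suc m) Pr (poly-< {d = 0} ℕ.0<1+n (poly-const (- σ y)))
      ky-inj : ∀ i j → emb i * y ≈ emb j * y → i ≡ j
      ky-inj i j e = emb-inj i j (*-cancelˡ y≉0 (trans (*-comm _ _) (trans e (*-comm _ _))))
      root : ∀ i → r (emb i * y) - σ y ≈ 0#
      root i = x≈y⇒x-y≈0 (+-cancelˡ (σ (emb i * y)) _ _
        (trans (sym (eq (emb i * y))) (shifted-K i)))

  σ-neg : ∀ x → σ (- x) ≈ - σ x
  σ-neg x = +-inverseˡ-unique _ _ (begin
    σ (- x) + σ x  ≈⟨ σ-+ (- x) x ⟨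
    σ (- x + x)    ≈⟨ σ-cong (-‿inverseˡ x) ⟩
    σ 0#           ≈⟨ σ-0 ⟩
    0#             ∎)

  σ-≈0 : ∀ {x} → σ x ≈ 0# → x ≈ 0#
  σ-≈0 {x} = go q
    where
    go : ∀ d → x ^ d ≈ 0# → x ≈ 0#
    go zero e = contradiction (sym e) 0≉1
    go (suc d) e with x ≟ 0#
    ... | yes x≈0 = x≈0
    ... | no x≉0  = go d (noZeroDivisors e x≉0)

  -- Otherwise x together with the q elements of K would give q + 1 roots of X^q - X.
  fixed⇒InK : ∀ {x} → σ x ≈ x → InK E x
  fixed⇒InK {x} σx≈x with Fin.any? (λ i → emb i ≟ x)
  ... | yes x∈K = x∈K
  ... | no x∉K  = contradiction (monicRoots≤degree P point (λ {i} {j} → point-inj i j) root) ℕ.1+n≰n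
    where
    P : Poly 1# q (λ x → x ^ q + - 1# * (x ^ 1))
    P = poly-cong q (+-identityʳ 1#) (λ _ → refl)
          (poly-+ q (poly-^ q) (poly-< 1<q (poly-scale 1 (- 1#) (poly-^ 1))))
    point : Fin (suc q) → Carrier
    point zero = x
    point (suc i) = emb i
    point-inj : ∀ i j → point i ≈ point j → i ≡ j
    point-inj zero zero _ = ≡.refl
    point-inj zero (suc j) e = contradiction (j , sym e) x∉K
    point-inj (suc i) zero e = contradiction (i , e) x∉K
    point-inj (suc i) (suc j) e = ≡.cong suc (emb-inj i j e)
    point-fixed : ∀ i → σ (point i) ≈ point i
    point-fixed zero = σx≈x
    point-fixed (suc i) = σ-emb i
    root : ∀ i → point i ^ q + - 1# * (point i ^ 1) ≈ 0#
    root i = trans (+-congʳ (point-fixed i))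
      (solve 1 (λ x → x :+ :- con (pos 1) :* (x :* con (pos 1)) := con (pos 0)) refl (point i))

  InK⇒fixed : ∀ {x} → InK E x → σ x ≈ x
  InK⇒fixed (i , e) = trans (sym (σ-cong e)) (trans (σ-emb i) e)

  -- Powers of σ and their independence

  σ^ : ℕ → Carrier → Carrier
  σ^ zero x    = x
  σ^ (suc i) x = σ (σ^ i x)

  σ^≈^ : ∀ i x → σ^ i x ≈ x ^ (q ^ℕ i)
  σ^≈^ zero x = sym (*-identityʳ x)
  σ^≈^ (suc i) x = begin
    σ (σ^ i x)            ≈⟨ σ-cong (σ^≈^ i x) ⟩
    (x ^ (q ^ℕ i)) ^ q    ≈⟨ ^-assocʳ x (q ^ℕ i) q ⟩
    x ^ (q ^ℕ i ℕ.* q)    ≡⟨ ≡.cong (x ^_) (ℕ.*-comm (q ^ℕ i) q) ⟩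
    x ^ (q ^ℕ suc i)      ∎

  σ^-cong : ∀ i {x y} → x ≈ y → σ^ i x ≈ σ^ i y
  σ^-cong zero e = e
  σ^-cong (suc i) e = σ-cong (σ^-cong i e)

  σ^-+ : ∀ i x y → σ^ i (x + y) ≈ σ^ i x + σ^ i y
  σ^-+ zero x y = refl
  σ^-+ (suc i) x y = trans (σ-cong (σ^-+ i x y)) (σ-+ _ _)

  σ^-* : ∀ i x y → σ^ i (x * y) ≈ σ^ i x * σ^ i y
  σ^-* zero x y = refl
  σ^-* (suc i) x y = trans (σ-cong (σ^-* i x y)) (σ-* _ _)

  σ^-neg : ∀ i x → σ^ i (- x) ≈ - σ^ i x
  σ^-neg zero x = refl
  σ^-neg (suc i) x = trans (σ-cong (σ^-neg i x)) (σ-neg _)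

  σ^-fixed : ∀ i {x} → σ x ≈ x → σ^ i x ≈ x
  σ^-fixed zero e = refl
  σ^-fixed (suc i) e = trans (σ-cong (σ^-fixed i e)) e

  σ^-∘ : ∀ i j x → σ^ (i ℕ.+ j) x ≈ σ^ i (σ^ j x)
  σ^-∘ zero j x = refl
  σ^-∘ (suc i) j x = σ-cong (σ^-∘ i j x)

  σ^n≈id : ∀ x → σ^ n x ≈ x
  σ^n≈id x = begin
    σ^ n x                       ≈⟨ σ^≈^ n x ⟩
    x ^ (q ^ℕ n)                 ≈⟨ ^-congˡ (q ^ℕ n) (at-index x) ⟨
    at (index x) ^ (q ^ℕ n)      ≈⟨ fermat at at-injective (λ i j → index (at i * at j) , at-index _)
                                         (index 0# , at-index 0#) (index x) ⟩
    at (index x)                 ≈⟨ at-index x ⟩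
    x                            ∎

  poly-σ^ : ∀ i → Poly 1# (q ^ℕ i) (σ^ i)
  poly-σ^ i = poly-cong (q ^ℕ i) refl (λ x → sym (σ^≈^ i x)) (poly-^ (q ^ℕ i))

  -- The q-polynomial y₀ l + y₁ l^q + ... with k terms, as a function of l.
  combination : (k : ℕ) → (ℕ → Carrier) → Carrier → Carrier
  combination zero y l    = 0#
  combination (suc k) y l = combination k y l + y k * σ^ k l

  -- The bound q^k, with coefficient zero there, is chosen so that adding the next term
  -- `y k * σ^ k l` gives a polynomial whose coefficient at q^k is `y k`.
  poly-combination : ∀ k y → Poly 0# (q ^ℕ k) (combination k y)
  poly-combination zero y = poly-raise 0 (poly-const 0#)
  poly-combination (suc k) y = poly-< (ℕ.^-monoʳ-< q 1<q (ℕ.n<1+n k))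
    (poly-+ (q ^ℕ k) (poly-combination k y) (poly-scale (q ^ℕ k) (y k) (poly-σ^ k)))

  -- With k terms the degree is at most q^(k-1) < q^n, yet all q^n elements are roots; so the top
  -- coefficient is zero, and the lower ones follow by induction.
  σ^-independent : ∀ k → k ≤ n → ∀ y → (∀ l → combination k y l ≈ 0#) → ∀ {i} → i < k → y i ≈ 0#
  σ^-independent (suc k) k<n y vanish {i} (s≤s i≤k) = helper (ℕ.m≤n⇒m<n∨m≡n i≤k)
    where
    yₖ≈0 : y k ≈ 0#
    yₖ≈0 = trans (solve 1 (λ y → y := con (pos 0) :+ y :* con (pos 1)) refl (y k))
      (manyRoots⇒leading≈0
        (poly-+ (q ^ℕ k) (poly-combination k y) (poly-scale (q ^ℕ k) (y k) (poly-σ^ k)))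
        (ℕ.^-monoʳ-< q 1<q k<n) at at-injective (λ i → vanish (at i)))
    vanish′ : ∀ l → combination k y l ≈ 0#
    vanish′ l = begin
      combination k y l                    ≈⟨ +-identityʳ _ ⟨
      combination k y l + 0#               ≈⟨ +-congˡ (trans (*-congʳ yₖ≈0) (zeroˡ _)) ⟨
      combination k y l + y k * σ^ k l     ≈⟨ vanish l ⟩
      0#                                   ∎
    helper : i < k ⊎ i ≡ k → y i ≈ 0#
    helper (inj₁ i<k)    = σ^-independent k (ℕ.<⇒≤ k<n) y vanish′ i<k
    helper (inj₂ ≡.refl) = yₖ≈0

  combination-cong : ∀ k y {l l′} → l ≈ l′ → combination k y l ≈ combination k y l′
  combination-cong zero y e    = refl
  combination-cong (suc k) y e = +-cong (combination-cong k y e) (*-congˡ (σ^-cong k e))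

-- The subfield L of order q^s

cofactor-≥ : ∀ q s {a b} .⦃ _ : ℕ.NonZero q ⦄ → q ^ℕ (s ℕ.+ s) ≤ a ℕ.* b → a ≤ q ^ℕ s → q ^ℕ s ≤ b
cofactor-≥ q s {a} {b} q^2s≤ab a≤q^s = ℕ.*-cancelˡ-≤ (q ^ℕ s) ⦃ ℕ.m^n≢0 q s ⦄ (begin
  q ^ℕ s ℕ.* q ^ℕ s   ≡⟨ ℕ.^-distribˡ-+-* q s s ⟨
  q ^ℕ (s ℕ.+ s)      ≤⟨ q^2s≤ab ⟩
  a ℕ.* b             ≤⟨ ℕ.*-monoˡ-≤ b a≤q^s ⟩
  q ^ℕ s ℕ.* b        ∎)
  where open ℕ.≤-Reasoning

module QuadraticSubfield {q n s : ℕ} (E : FieldExt q n) (n≡s+s : n ≡ s ℕ.+ s) (s≥1 : s ≥ 1) where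
  open FiniteField E
  open SetoidReasoning setoid

  conj : Carrier → Carrier
  conj = σ^ s

  conj-conj : ∀ x → conj (conj x) ≈ x
  conj-conj x = begin
    σ^ s (σ^ s x)   ≈⟨ σ^-∘ s s x ⟨
    σ^ (s ℕ.+ s) x  ≡⟨ ≡.cong (λ m → σ^ m x) n≡s+s ⟨
    σ^ n x          ≈⟨ σ^n≈id x ⟩
    x               ∎

  InL : Carrier → Set
  InL x = conj x ≈ x

  private
    1<q^s : 1 < q ^ℕ s
    1<q^s = ℕ.<-≤-trans 1<q (≡.subst (_≤ q ^ℕ s) (ℕ.*-identityʳ q) (ℕ.^-monoʳ-≤ q s≥1))

    -- With c = -1 the roots are the elements of L; with c = 1 they include the image of `φ`.
    poly-conj+scaled : ∀ c → Poly 1# (q ^ℕ s) (λ x → conj x + c * (x ^ 1))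
    poly-conj+scaled c = poly-cong (q ^ℕ s) (+-identityʳ 1#) (λ _ → refl)
      (poly-+ (q ^ℕ s) (poly-σ^ s) (poly-< 1<q^s (poly-scale 1 c (poly-^ 1))))

    φ : Carrier → Carrier
    φ x = conj x - x

    φ-cong : ∀ {x y} → x ≈ y → φ x ≈ φ y
    φ-cong e = +-cong (σ^-cong s e) (-‿cong e)

    ImageIndex : Fin (q ^ℕ n) → Set
    ImageIndex i = ∃ λ x → φ x ≈ at i

    abstract
      fixed : ∃ λ m → Σ (Fin m → Fin (q ^ℕ n)) λ e →
        (∀ {i j} → e i ≡ e j → i ≡ j) × (∀ i → InL (at (e i))) × (∀ j → InL (at j) → ∃ λ i → e i ≡ j)
      fixed = enumerateSubset (λ i → conj (at i) ≟ at i)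

      image : ∃ λ m → Σ (Fin m → Fin (q ^ℕ n)) λ e →
        (∀ {i j} → e i ≡ e j → i ≡ j) × (∀ i → ImageIndex (e i)) × (∀ j → ImageIndex j → ∃ λ i → e i ≡ j)
      image = enumerateSubset (λ i → any? (λ e e′ → trans (φ-cong (sym e)) e′) (λ x → φ x ≟ at i))

    m_L = proj₁ fixed
    m_I = proj₁ image
    e_L = proj₁ (proj₂ fixed)
    e_I = proj₁ (proj₂ image)
    e_L-inj : ∀ {i j} → e_L i ≡ e_L j → i ≡ j
    e_L-inj = proj₁ (proj₂ (proj₂ fixed))
    e_L-mem = proj₁ (proj₂ (proj₂ (proj₂ fixed)))
    e_L-cover = proj₂ (proj₂ (proj₂ (proj₂ fixed)))
    e_I-mem = proj₁ (proj₂ (proj₂ (proj₂ image)))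
    e_I-cover = proj₂ (proj₂ (proj₂ (proj₂ image)))

    m_L≤q^s : m_L ≤ q ^ℕ s
    m_L≤q^s = monicRoots≤degree (poly-conj+scaled (- 1#)) (at ∘ e_L) (λ e → e_L-inj (at-injective e))
      λ i → trans (+-congʳ (e_L-mem i))
        (solve 1 (λ x → x :+ :- con (pos 1) :* (x :* con (pos 1)) := con (pos 0)) refl (at (e_L i)))

    -- conj x + x vanishes on the image of φ.
    m_I≤q^s : m_I ≤ q ^ℕ s
    m_I≤q^s = monicRoots≤degree (poly-conj+scaled 1#) (at ∘ e_I)
      (λ e → proj₁ (proj₂ (proj₂ image)) (at-injective e)) λ i → root (proj₂ (e_I-mem i))
      where
      root : ∀ {x y} → φ x ≈ y → conj y + 1# * (y ^ 1) ≈ 0#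
      root {x} {y} e = begin
        conj y + 1# * (y ^ 1)             ≈⟨ +-cong (σ^-cong s (sym e)) (*-congˡ (*-congʳ (sym e))) ⟩
        conj (conj x - x) + 1# * ((conj x - x) ^ 1)
          ≈⟨ +-congʳ (trans (σ^-+ s _ _) (+-cong (conj-conj x) (σ^-neg s x))) ⟩
        (x - conj x) + 1# * ((conj x - x) ^ 1)
          ≈⟨ solve 2 (λ x c → (x :- c) :+ con (pos 1) :* ((c :- x) :* con (pos 1)) := con (pos 0))
                   refl x (conj x) ⟩
        0#  ∎

    imageIndex : ∀ x → ∃ λ i → e_I i ≡ index (φ x)
    imageIndex x = e_I-cover (index (φ x)) (x , sym (at-index (φ x)))

    -- A representative of the coset x + L depending only on φ x.
    rep : Carrier → Carrier
    rep x = proj₁ (e_I-mem (proj₁ (imageIndex x)))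

    φ-rep : ∀ x → φ (rep x) ≈ φ x
    φ-rep x = trans (proj₂ (e_I-mem (proj₁ (imageIndex x))))
      (trans (reflexive (≡.cong at (proj₂ (imageIndex x)))) (at-index (φ x)))

    x-rep∈L : ∀ x → InL (x - rep x)
    x-rep∈L x = begin
      conj (x - r)              ≈⟨ trans (σ^-+ s x (- r)) (+-congˡ (σ^-neg s r)) ⟩
      conj x - conj r
        ≈⟨ solve 4 (λ x r cx cr → cx :- cr := (x :- r) :+ ((cx :- x) :- (cr :- r)))
                 refl x r (conj x) (conj r) ⟩
      (x - r) + (φ x - φ r)     ≈⟨ +-congˡ (x≈y⇒x-y≈0 (sym (φ-rep x))) ⟩
      (x - r) + 0#              ≈⟨ +-identityʳ _ ⟩
      x - r                     ∎
      where r = rep x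

    InL-resp : ∀ {x y} → x ≈ y → InL x → InL y
    InL-resp e h = trans (σ^-cong s (sym e)) (trans h e)

    indexL : ∀ x → InL x → ∃ λ i → at (e_L i) ≈ x
    indexL x x∈L =
      let i , eq = e_L-cover (index x) (InL-resp (sym (at-index x)) x∈L)
      in i , trans (reflexive (≡.cong at eq)) (at-index x)

    imageOf : Fin (q ^ℕ n) → Fin m_I
    imageOf i = proj₁ (imageIndex (at i))

    offset : Fin (q ^ℕ n) → Fin m_L
    offset i = proj₁ (indexL (at i - rep (at i)) (x-rep∈L (at i)))

    split : Fin (q ^ℕ n) → Fin (m_I ℕ.* m_L)
    split i = combine (imageOf i) (offset i)

    split-injective : ∀ {i j} → split i ≡ split j → i ≡ j
    split-injective {i} {j} e = at-injective
      (difference-injective rep≈ (trans (sym (offset-correct i))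
        (trans (reflexive (≡.cong (λ k → at (e_L k)) offset≡)) (offset-correct j))))
      where
      difference-injective : ∀ {x y r r′} → r ≈ r′ → x - r ≈ y - r′ → x ≈ y
      difference-injective {x} {y} {r} {r′} e e′ = begin
        x              ≈⟨ solve 2 (λ x r → x := (x :- r) :+ r) refl x r ⟩
        (x - r) + r    ≈⟨ +-cong e′ e ⟩
        (y - r′) + r′  ≈⟨ solve 2 (λ x r → x := (x :- r) :+ r) refl y r′ ⟨
        y              ∎
      offset-correct : ∀ k → at (e_L (offset k)) ≈ at k - rep (at k)
      offset-correct k = proj₂ (indexL (at k - rep (at k)) (x-rep∈L (at k)))
      image≡ : imageOf i ≡ imageOf j
      image≡ = Fin.combine-injectiveˡ (imageOf i) (offset i) (imageOf j) (offset j) e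
      offset≡ : offset i ≡ offset j
      offset≡ = Fin.combine-injectiveʳ (imageOf i) (offset i) (imageOf j) (offset j) e
      rep≈ : rep (at i) ≈ rep (at j)
      rep≈ = reflexive (≡.cong (λ k → proj₁ (e_I-mem k)) image≡)

    -- Each x is determined by `φ x` and the element `x - rep x` of L. So q^(2s) is at most the size
    -- of the image of `φ` times the size of L, and the first factor is at most q^s.
    q^s≤m_L : q ^ℕ s ≤ m_L
    q^s≤m_L = cofactor-≥ q s
      (≡.subst (λ k → q ^ℕ k ≤ m_I ℕ.* m_L) n≡s+s (Fin.injective⇒≤ {f = split} split-injective)) m_I≤q^s

    m_L≡q^s : m_L ≡ q ^ℕ s
    m_L≡q^s = ℕ.≤-antisym m_L≤q^s q^s≤m_L

    resize : Fin (q ^ℕ s) → Fin m_L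
    resize = Fin.cast (≡.sym m_L≡q^s)

  L-0 : InL 0#
  L-0 = σ^-fixed s σ-0

  L-1 : InL 1#
  L-1 = σ^-fixed s σ-1

  L-+ : ∀ {x y} → InL x → InL y → InL (x + y)
  L-+ hx hy = trans (σ^-+ s _ _) (+-cong hx hy)

  L-* : ∀ {x y} → InL x → InL y → InL (x * y)
  L-* hx hy = trans (σ^-* s _ _) (*-cong hx hy)

  L-neg : ∀ {x} → InL x → InL (- x)
  L-neg hx = trans (σ^-neg s _) (-‿cong hx)

  L-inverse : ∀ {x y} → InL x → ¬ x ≈ 0# → x * y ≈ 1# → InL y
  L-inverse {x} {y} hx x≉0 e = *-cancelˡ x≉0 (begin
    x * conj y         ≈⟨ *-congʳ hx ⟨
    conj x * conj y    ≈⟨ σ^-* s x y ⟨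
    conj (x * y)       ≈⟨ σ^-cong s e ⟩
    conj 1#            ≈⟨ L-1 ⟩
    1#                 ≈⟨ e ⟨
    x * y              ∎)

  ringL : CommutativeRing 0ℓ 0ℓ
  ringL = record
    { Carrier = Σ Carrier InL
    ; _≈_ = λ x y → proj₁ x ≈ proj₁ y
    ; _+_ = λ x y → proj₁ x + proj₁ y , L-+ (proj₂ x) (proj₂ y)
    ; _*_ = λ x y → proj₁ x * proj₁ y , L-* (proj₂ x) (proj₂ y)
    ; -_  = λ x → - proj₁ x , L-neg (proj₂ x)
    ; 0#  = 0# , L-0
    ; 1#  = 1# , L-1
    ; isCommutativeRing = RingMonomorphism.isCommutativeRing inclusion isCommutativeRing }
    where
    inclusion : IsRingMonomorphism _ (Ring.rawRing ring) proj₁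
    inclusion = record
      { isRingHomomorphism = record
        { isSemiringHomomorphism = record
          { isNearSemiringHomomorphism = record
            { +-isMonoidHomomorphism = record
              { isMagmaHomomorphism = record
                { isRelHomomorphism = record { cong = id } ; homo = λ _ _ → refl }
              ; ε-homo = refl }
            ; *-homo = λ _ _ → refl }
          ; 1#-homo = refl }
        ; -‿homo = λ _ → refl }
      ; injective = id }

  subfield : FieldExt q s
  subfield = record
    { fieldRing = ringL
    ; 0≉1 = 0≉1
    ; inverse = λ { (x , hx) x≉0 → let y , e = inverse x x≉0 in (y , L-inverse hx x≉0 e) , e }
    ; card = record
      { to = λ i → at (e_L (resize i)) , e_L-mem (resize i)
      ; from = λ { (x , hx) → Fin.cast m_L≡q^s (proj₁ (indexL x hx)) }
      ; to-cong = λ { ≡.refl → refl }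
      ; from-cong = λ { {x , hx} {y , hy} e → ≡.cong (Fin.cast m_L≡q^s) (e_L-inj (at-injective
          (trans (proj₂ (indexL x hx)) (trans e (sym (proj₂ (indexL y hy))))))) }
      ; inverse = (λ { {x , hx} ≡.refl → trans
            (reflexive (≡.cong (at ∘ e_L) (Fin.cast-involutive (≡.sym m_L≡q^s) m_L≡q^s _)))
            (proj₂ (indexL x hx)) })
        , (λ { {i} {x , hx} e → ≡.trans (≡.cong (Fin.cast m_L≡q^s) (e_L-inj (at-injective
              (trans (proj₂ (indexL x hx)) e))))
            (Fin.cast-involutive m_L≡q^s (≡.sym m_L≡q^s) i) }) }
    ; emb = λ i → emb i , σ^-fixed s (σ-emb i)
    ; emb-inj = emb-inj
    ; K-0 = K-0
    ; K-1 = K-1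
    ; K-+ = K-+
    ; K-* = K-* }

-- Coordinate vectors over a finite field

module VectorSpace {q n : ℕ} (E : FieldExt q n) where
  open FiniteField E

  infix 4 _≋_
  infixl 6 _⊹_
  infixr 7 _•_

  _≋_ : ∀ {r} → Vect E r → Vect E r → Set
  _≋_ = _≈V_ E

  _⊹_ : ∀ {r} → Vect E r → Vect E r → Vect E r
  (u ⊹ v) j = u j + v j

  _•_ : ∀ {r} → Carrier → Vect E r → Vect E r
  _•_ = _·V_ E

  𝟎 : ∀ {r} → Vect E r
  𝟎 = zeroV E

  vectSetoid : ℕ → Setoid 0ℓ 0ℓ
  vectSetoid r = record
    { Carrier = Vect E r ; _≈_ = _≋_
    ; isEquivalence = record { refl = λ _ → refl ; sym = λ e j → sym (e j) ; trans = λ e e′ j → trans (e j) (e′ j) } }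

  vectEnumeration : ∀ r → Enumeration ((q ^ℕ n) ^ℕ r) (vectSetoid r)
  vectEnumeration r = record
    { at = λ i j → at (finToFun i j)
    ; index = λ v → funToFin (index ∘ v)
    ; at-index = λ v j → trans (reflexive (≡.cong at (Fin.finToFun-funToFin (index ∘ v) j))) (at-index (v j))
    ; at-injective = λ {i} {k} e → ≡.trans (≡.sym (Fin.funToFin-finToFin {r} i))
        (≡.trans (funToFin-cong (λ j → at-injective (e j))) (Fin.funToFin-finToFin {r} k)) }
    where
    funToFin-cong : ∀ {m k} {f g : Fin m → Fin k} → (∀ j → f j ≡ g j) → funToFin f ≡ funToFin g
    funToFin-cong {zero} e = ≡.refl
    funToFin-cong {suc m} e = ≡.cong₂ combine (e zero) (funToFin-cong (e ∘ suc))

  module V {r : ℕ} where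
    open Setoid (vectSetoid r) public hiding (_≈_; Carrier)
    open Enumeration (vectEnumeration r) public

-- A semilinear map of L³ without invariant lines or planes

-- f is the companion map of the skew polynomial X³ - X - c; the field E plays the role of L.
module CompanionMap {q n : ℕ} (E : FieldExt q n) (n≥1 : n ≥ 1) where
  open FiniteField E
  open VectorSpace E
  open SetoidReasoning setoid

  private
    B : Carrier → Carrier
    B w = σ (σ w) * (σ w * w) - σ (σ w)

    B-cong : ∀ {x y} → x ≈ y → B x ≈ B y
    B-cong e = +-cong (*-cong (σ-cong (σ-cong e)) (*-cong (σ-cong e) e)) (-‿cong (σ-cong (σ-cong e)))

    B0≈B1 : B 0# ≈ B 1#
    B0≈B1 = begin
      B 0#   ≈⟨ +-cong (*-congˡ (zeroʳ _)) (-‿cong (trans (σ-cong σ-0) σ-0)) ⟩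
      σ (σ 0#) * 0# - 0#   ≈⟨ solve 1 (λ s → s :* con (pos 0) :- con (pos 0) := con (pos 0)) refl (σ (σ 0#)) ⟩
      0#     ≈⟨ solve 0 (con (pos 1) :* (con (pos 1) :* con (pos 1)) :- con (pos 1) := con (pos 0)) refl ⟨
      1# * (1# * 1#) - 1#
        ≈⟨ +-cong (*-cong σσ1 (*-congʳ σ-1)) (-‿cong σσ1) ⟨
      B 1#   ∎
      where σσ1 = trans (σ-cong σ-1) σ-1

    missed : ∃ λ d → ∀ w → ¬ B w ≈ d
    missed = collision⇒missed B-cong B0≈B1 0≉1

    σ-injective : ∀ {x y} → σ x ≈ σ y → x ≈ y
    σ-injective {x} {y} e = x-y≈0⇒x≈y (σ-≈0 (trans (σ-+ x (- y))
      (trans (+-congˡ (σ-neg y)) (x≈y⇒x-y≈0 e))))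

    preimage : ∃ λ c → σ (σ c) ≈ proj₁ missed
    preimage = injective⇒surjective′ (λ e → σ-injective (σ-injective e)) (proj₁ missed)

    abstract
      c : Carrier
      c = proj₁ preimage

      B-misses : ∀ w → ¬ σ (σ w) * (σ w * w) ≈ σ (σ c) + σ (σ w)
      B-misses w e = proj₂ missed w (begin
        B w                            ≈⟨ +-congʳ e ⟩
        (σ (σ c) + σ (σ w)) - σ (σ w)  ≈⟨ solve 2 (λ a b → (a :+ b) :- b := a) refl _ _ ⟩
        σ (σ c)                        ≈⟨ proj₂ preimage ⟩
        proj₁ missed                   ∎)

      c≉0 : ¬ c ≈ 0#
      c≉0 c≈0 = B-misses 0# (begin
        σ (σ 0#) * (σ 0# * 0#)   ≈⟨ trans (*-congˡ (zeroʳ _)) (zeroʳ _) ⟩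
        0#                       ≈⟨ trans (σ-cong σ-0) σ-0 ⟨
        σ (σ 0#)                 ≈⟨ σ-cong (σ-cong c≈0) ⟨
        σ (σ c)                  ≈⟨ +-identityʳ _ ⟨
        σ (σ c) + 0#             ≈⟨ +-congˡ (trans (σ-cong σ-0) σ-0) ⟨
        σ (σ c) + σ (σ 0#)       ∎)

  f : Vect E 3 → Vect E 3
  f x 0F = c * σ (x 2F)
  f x 1F = σ (x 0F) + σ (x 2F)
  f x 2F = σ (x 1F)

  f-cong : ∀ {x y} → x ≋ y → f x ≋ f y
  f-cong e 0F = *-congˡ (σ-cong (e 2F))
  f-cong e 1F = +-cong (σ-cong (e 0F)) (σ-cong (e 2F))
  f-cong e 2F = σ-cong (e 1F)

  f-+ : ∀ x y → f (x ⊹ y) ≋ f x ⊹ f y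
  f-+ x y 0F = trans (*-congˡ (σ-+ _ _)) (distribˡ _ _ _)
  f-+ x y 1F = trans (+-cong (σ-+ _ _) (σ-+ _ _))
    (solve 4 (λ a b c d → (a :+ b) :+ (c :+ d) := (a :+ c) :+ (b :+ d)) refl _ _ _ _)
  f-+ x y 2F = σ-+ _ _

  f-• : ∀ a x → f (a • x) ≋ σ a • f x
  f-• a x 0F = trans (*-congˡ (σ-* _ _)) (solve 3 (λ c a x → c :* (a :* x) := a :* (c :* x)) refl _ _ _)
  f-• a x 1F = trans (+-cong (σ-* _ _) (σ-* _ _)) (sym (distribˡ _ _ _))
  f-• a x 2F = σ-* _ _

  f-≋0 : ∀ {x} → f x ≋ 𝟎 → x ≋ 𝟎
  f-≋0 {x} e = λ { 0F → σ-≈0 (trans (sym (+-identityʳ _)) (trans (+-congˡ (sym σx₂≈0)) (e 1F)))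
                 ; 1F → σ-≈0 (e 2F) ; 2F → σ-≈0 σx₂≈0 }
    where
    σx₂≈0 : σ (x 2F) ≈ 0#
    σx₂≈0 = noZeroDivisors (e 0F) c≉0

  f-0 : f 𝟎 ≋ 𝟎
  f-0 0F = trans (*-congˡ σ-0) (zeroʳ c)
  f-0 1F = trans (+-cong σ-0 σ-0) (+-identityʳ _)
  f-0 2F = σ-0

  -- An eigenvector scaled to have last coordinate 1 exhibits σ²c as a value of B.
  noEigenvector : ∀ {x u} → ¬ x ≋ 𝟎 → ¬ f x ≋ u • x
  noEigenvector {x} {u} x≉0 e = B-misses w (begin
    σ (σ w) * (σ w * w)        ≈⟨ *-congˡ (*-congˡ e₂) ⟨
    σ (σ w) * (σ w * σ X₁)     ≈⟨ *-congˡ (σ-* w X₁) ⟨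
    σ (σ w) * σ (w * X₁)       ≈⟨ *-congˡ (σ-cong e₁) ⟨
    σ (σ w) * σ (σ X₀ + 1#)    ≈⟨ *-congˡ (trans (σ-+ _ _) (+-congˡ σ-1)) ⟩
    σ (σ w) * (σ (σ X₀) + 1#)  ≈⟨ trans (distribˡ _ _ _) (+-congˡ (*-identityʳ _)) ⟩
    σ (σ w) * σ (σ X₀) + σ (σ w)  ≈⟨ +-congʳ (trans (σ-cong (σ-* w X₀)) (σ-* _ _)) ⟨
    σ (σ (w * X₀)) + σ (σ w)   ≈⟨ +-congʳ (σ-cong (σ-cong e₀)) ⟨
    σ (σ c) + σ (σ w)          ∎)
    where
    x₂≉0 : ¬ x 2F ≈ 0#
    x₂≉0 x₂≈0 = x≉0 λ { 0F → x₀≈0 ; 1F → x₁≈0 ; 2F → x₂≈0 }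
      where
      x₁≈0 : x 1F ≈ 0#
      x₁≈0 = σ-≈0 (trans (e 2F) (trans (*-congˡ x₂≈0) (zeroʳ u)))
      x₀≈0 : x 0F ≈ 0#
      x₀≈0 = σ-≈0 (begin
        σ (x 0F)              ≈⟨ +-identityʳ _ ⟨
        σ (x 0F) + 0#         ≈⟨ +-congˡ (trans (σ-cong x₂≈0) σ-0) ⟨
        σ (x 0F) + σ (x 2F)   ≈⟨ e 1F ⟩
        u * x 1F              ≈⟨ trans (*-congˡ x₁≈0) (zeroʳ u) ⟩
        0#                    ∎)
    i = proj₁ (inverse (x 2F) x₂≉0)
    x₂i≈1 : x 2F * i ≈ 1#
    x₂i≈1 = proj₂ (inverse (x 2F) x₂≉0)
    X : Vect E 3
    X = i • x
    X₀ = X 0F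
    X₁ = X 1F
    w = σ i * u * x 2F
    X₂≈1 : X 2F ≈ 1#
    X₂≈1 = trans (*-comm _ _) x₂i≈1
    scaled : f X ≋ w • X
    scaled j = begin
      f X j                          ≈⟨ f-• i x j ⟩
      σ i * f x j                    ≈⟨ *-congˡ (e j) ⟩
      σ i * (u * x j)                ≈⟨ *-identityʳ _ ⟨
      σ i * (u * x j) * 1#           ≈⟨ *-congˡ x₂i≈1 ⟨
      σ i * (u * x j) * (x 2F * i)
        ≈⟨ solve 5 (λ s u x y i → s :* (u :* x) :* (y :* i) := s :* u :* y :* (i :* x)) refl _ _ _ _ _ ⟩
      w * (i * x j)                  ∎
    σX₂≈1 : σ (X 2F) ≈ 1#
    σX₂≈1 = trans (σ-cong X₂≈1) σ-1
    e₀ : c ≈ w * X₀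
    e₀ = trans (trans (sym (*-identityʳ c)) (*-congˡ (sym σX₂≈1))) (scaled 0F)
    e₁ : σ X₀ + 1# ≈ w * X₁
    e₁ = trans (+-congˡ (sym σX₂≈1)) (scaled 1F)
    e₂ : σ X₁ ≈ w
    e₂ = trans (scaled 2F) (trans (*-congˡ X₂≈1) (*-identityʳ w))

  module V₃ = V {3}

  -- The cross product carries the linear algebra of L³: it vanishes exactly on linearly dependent
  -- pairs, and otherwise it is the functional whose kernel is the plane spanned by the pair.
  _⨯_ : Vect E 3 → Vect E 3 → Vect E 3
  (x ⨯ y) 0F = x 1F * y 2F - x 2F * y 1F
  (x ⨯ y) 1F = x 2F * y 0F - x 0F * y 2F
  (x ⨯ y) 2F = x 0F * y 1F - x 1F * y 0F

  ⨯≋0⇒proportional : ∀ {x y} → x ⨯ y ≋ 𝟎 → ∀ i j → x i * y j ≈ x j * y i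
  ⨯≋0⇒proportional e 0F 0F = refl
  ⨯≋0⇒proportional e 0F 1F = x-y≈0⇒x≈y (e 2F)
  ⨯≋0⇒proportional e 0F 2F = sym (x-y≈0⇒x≈y (e 1F))
  ⨯≋0⇒proportional e 1F 0F = sym (x-y≈0⇒x≈y (e 2F))
  ⨯≋0⇒proportional e 1F 1F = refl
  ⨯≋0⇒proportional e 1F 2F = x-y≈0⇒x≈y (e 0F)
  ⨯≋0⇒proportional e 2F 0F = x-y≈0⇒x≈y (e 1F)
  ⨯≋0⇒proportional e 2F 1F = sym (x-y≈0⇒x≈y (e 0F))
  ⨯≋0⇒proportional e 2F 2F = refl

  nonzeroCoordinate : ∀ {r} {x : Vect E r} → ¬ x ≋ 𝟎 → ∃ λ j → ¬ x j ≈ 0#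
  nonzeroCoordinate {r} {x} x≉0 = Fin.¬∀⟶∃¬ r _ (λ j → x j ≟ 0#) x≉0

  ⨯≋0⇒multiple : ∀ {x y} → ¬ x ≋ 𝟎 → x ⨯ y ≋ 𝟎 → ∃ λ u → y ≋ u • x
  ⨯≋0⇒multiple {x} {y} x≉0 e with nonzeroCoordinate x≉0
  ... | j , xj≉0 with inverse (x j) xj≉0
  ... | i , xji≈1 = i * y j , λ k → begin
    y k               ≈⟨ *-identityˡ _ ⟨
    1# * y k          ≈⟨ *-congʳ xji≈1 ⟨
    x j * i * y k     ≈⟨ solve 3 (λ x i y → x :* i :* y := i :* (x :* y)) refl _ _ _ ⟩
    i * (x j * y k)   ≈⟨ *-congˡ (⨯≋0⇒proportional e j k) ⟩
    i * (x k * y j)   ≈⟨ solve 3 (λ x i y → i :* (x :* y) := i :* y :* x) refl _ _ _ ⟩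
    i * y j * x k     ∎

  infixl 7 _∙_
  _∙_ : Vect E 3 → Vect E 3 → Carrier
  k ∙ v = k 0F * v 0F + k 1F * v 1F + k 2F * v 2F

  ∙-cong : ∀ k {u v} → u ≋ v → k ∙ u ≈ k ∙ v
  ∙-cong k e = +-cong (+-cong (*-congˡ (e 0F)) (*-congˡ (e 1F))) (*-congˡ (e 2F))

  ∙-+ : ∀ k u v → k ∙ (u ⊹ v) ≈ k ∙ u + k ∙ v
  ∙-+ k u v = solve 9 (λ a b c u v w x y z →
      a :* (u :+ x) :+ b :* (v :+ y) :+ c :* (w :+ z)
      := (a :* u :+ b :* v :+ c :* w) :+ (a :* x :+ b :* y :+ c :* z)) refl
      (k 0F) (k 1F) (k 2F) (u 0F) (u 1F) (u 2F) (v 0F) (v 1F) (v 2F)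

  ∙-• : ∀ k a v → k ∙ (a • v) ≈ a * (k ∙ v)
  ∙-• k a v = solve 7 (λ p q r a u v w →
      p :* (a :* u) :+ q :* (a :* v) :+ r :* (a :* w) := a :* (p :* u :+ q :* v :+ r :* w)) refl
      (k 0F) (k 1F) (k 2F) a (v 0F) (v 1F) (v 2F)

  ∙-nondegenerate : ∀ {k} → ¬ k ≋ 𝟎 → ∃ λ v → ¬ k ∙ v ≈ 0#
  ∙-nondegenerate {k} k≉0 with nonzeroCoordinate k≉0
  ... | 0F , kj≉0 = (λ { 0F → 1# ; 1F → 0# ; 2F → 0# }) , kj≉0 ∘ trans (solve 3 (λ a b c →
          a := a :* con (pos 1) :+ b :* con (pos 0) :+ c :* con (pos 0)) refl _ _ _)
  ... | 1F , kj≉0 = (λ { 0F → 0# ; 1F → 1# ; 2F → 0# }) , kj≉0 ∘ trans (solve 3 (λ a b c →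
          b := a :* con (pos 0) :+ b :* con (pos 1) :+ c :* con (pos 0)) refl (k 0F) (k 1F) (k 2F))
  ... | 2F , kj≉0 = (λ { 0F → 0# ; 1F → 0# ; 2F → 1# }) , kj≉0 ∘ trans (solve 3 (λ a b c →
          c := a :* con (pos 0) :+ b :* con (pos 0) :+ c :* con (pos 1)) refl (k 0F) (k 1F) (k 2F))

  σ-minor : ∀ a b d e → σ (a * b - d * e) ≈ σ a * σ b - σ d * σ e
  σ-minor a b d e = trans (σ-+ _ _) (+-cong (σ-* _ _) (trans (σ-neg _) (-‿cong (σ-* _ _))))

  -- A functional k with k (g v) = σ (k v) makes g^n - 1 map into the kernel of k, so g^n fixes a nonzero z;
  -- averaging a multiple of z over the powers of g then gives an eigenvector of f.
  module SemiInvariantFunctional (k : Vect E 3) (k≉0 : ¬ k ≋ 𝟎) (ν u : Carrier) (uν≈1 : u * ν ≈ 1#)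
                                 (semi : ∀ v → k ∙ (ν • f v) ≈ σ (k ∙ v)) where
    g : Vect E 3 → Vect E 3
    g v = ν • f v

    g-cong : ∀ {v w} → v ≋ w → g v ≋ g w
    g-cong e j = *-congˡ (f-cong e j)

    g-+ : ∀ v w → g (v ⊹ w) ≋ g v ⊹ g w
    g-+ v w j = trans (*-congˡ (f-+ v w j)) (distribˡ _ _ _)

    g-• : ∀ a v → g (a • v) ≋ σ a • g v
    g-• a v j = trans (*-congˡ (f-• a v j)) (solve 3 (λ n s f → n :* (s :* f) := s :* (n :* f)) refl _ _ _)

    g^ : ℕ → Vect E 3 → Vect E 3
    g^ zero v = v
    g^ (suc i) v = g (g^ i v)

    g^-cong : ∀ i {v w} → v ≋ w → g^ i v ≋ g^ i w
    g^-cong zero e = e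
    g^-cong (suc i) e = g-cong (g^-cong i e)

    g^-+ : ∀ i v w → g^ i (v ⊹ w) ≋ g^ i v ⊹ g^ i w
    g^-+ zero v w j = refl
    g^-+ (suc i) v w = V₃.trans (g-cong (g^-+ i v w)) (g-+ _ _)

    g^-• : ∀ i a v → g^ i (a • v) ≋ σ^ i a • g^ i v
    g^-• zero a v j = refl
    g^-• (suc i) a v = V₃.trans (g-cong (g^-• i a v)) (g-• _ _)

    g^-semi : ∀ i v → k ∙ g^ i v ≈ σ^ i (k ∙ v)
    g^-semi zero v = refl
    g^-semi (suc i) v = trans (semi (g^ i v)) (σ-cong (g^-semi i v))

    -- Subtraction is written as a multiple by `- 1#`, so that `∙-•` and `g^-•` apply to it.
    h : Vect E 3 → Vect E 3
    h v = g^ n v ⊹ (- 1#) • v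

    k∙h≈0 : ∀ v → k ∙ h v ≈ 0#
    k∙h≈0 v = begin
      k ∙ h v                           ≈⟨ trans (∙-+ k (g^ n v) ((- 1#) • v)) (+-congˡ (∙-• k (- 1#) v)) ⟩
      k ∙ g^ n v + - 1# * (k ∙ v)       ≈⟨ +-congʳ (trans (g^-semi n v) (σ^n≈id _)) ⟩
      k ∙ v + - 1# * (k ∙ v)            ≈⟨ trans (+-congˡ (-1*x≈-x _)) (-‿inverseʳ _) ⟩
      0#                                ∎

    Fixed : Vect E 3 → Set
    Fixed z = ¬ z ≋ 𝟎 × g^ n z ≋ z

    -- Rank-nullity by counting: two arguments with equal values under `h` differ by a vector fixed
    -- by g^n. Without nonzero fixed vectors `h` is therefore injective, hence onto, and reaches a
    -- vector outside the kernel of `k`.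
    fixedVector : ∃ Fixed
    fixedVector with V₃.any? {P = Fixed}
      (λ e (z≉0 , gz≋z) → (z≉0 ∘ V₃.trans e) , V₃.trans (g^-cong n (V₃.sym e)) (V₃.trans gz≋z e))
      (λ z → ¬? (z V₃.≟ 𝟎) ×-dec (g^ n z V₃.≟ z))
    ... | yes found = found
    ... | no none = contradiction (trans (∙-cong k (V₃.sym (proj₂ hit))) (k∙h≈0 (proj₁ hit))) (proj₂ v₀)
      where
      difference-fixed : ∀ {a b} → h a ≋ h b → g^ n (a ⊹ (- 1#) • b) ≋ a ⊹ (- 1#) • b
      difference-fixed {a} {b} e j = begin
        g^ n (a ⊹ (- 1#) • b) j         ≈⟨ g^-+ n a ((- 1#) • b) j ⟩
        g^ n a j + g^ n ((- 1#) • b) j  ≈⟨ +-congˡ (g^-• n (- 1#) b j) ⟩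
        g^ n a j + σ^ n (- 1#) * g^ n b j  ≈⟨ +-congˡ (*-congʳ (σ^n≈id (- 1#))) ⟩
        g^ n a j + - 1# * g^ n b j
          ≈⟨ solve 4 (λ a b p r → p :+ (:- con (pos 1)) :* r
               := (a :+ (:- con (pos 1)) :* b) :+ ((p :+ (:- con (pos 1)) :* a) :- (r :+ (:- con (pos 1)) :* b)))
               refl (a j) (b j) (g^ n a j) (g^ n b j) ⟩
        (a j + - 1# * b j) + (h a j - h b j)  ≈⟨ +-congˡ (x≈y⇒x-y≈0 (e j)) ⟩
        (a j + - 1# * b j) + 0#               ≈⟨ +-identityʳ _ ⟩
        a j + - 1# * b j                      ∎
      h-injective : ∀ {a b} → h a ≋ h b → a ≋ b
      h-injective {a} {b} e with (a ⊹ (- 1#) • b) V₃.≟ 𝟎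
      ... | yes a-b≋0 = λ j → x-y≈0⇒x≈y (trans (+-congˡ (sym (-1*x≈-x (b j)))) (a-b≋0 j))
      ... | no a-b≉0  = contradiction (a ⊹ (- 1#) • b , a-b≉0 , difference-fixed e) none
      v₀ = ∙-nondegenerate k≉0
      hit = V₃.injective⇒surjective′ {f = h} h-injective (proj₁ v₀)

    z = proj₁ fixedVector

    average : ℕ → Carrier → Vect E 3
    average zero l    = 𝟎
    average (suc i) l = average i l ⊹ g^ i (l • z)

    -- Telescoping: `g` moves each summand to the next one, and the two end terms stand on opposite
    -- sides. For i = n they agree, because g^n fixes `z` and σ^n fixes `l`.
    g-average : ∀ i l → g (average i l) ⊹ l • z ≋ average i l ⊹ g^ i (l • z)
    g-average zero l j = +-congʳ (trans (*-congˡ (f-0 j)) (zeroʳ ν))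
    g-average (suc i) l j = begin
      g (average i l ⊹ g^ i (l • z)) j + l * z j          ≈⟨ +-congʳ (g-+ _ _ j) ⟩
      g (average i l) j + g^ (suc i) (l • z) j + l * z j
        ≈⟨ solve 3 (λ a b c → a :+ b :+ c := (a :+ c) :+ b) refl _ _ _ ⟩
      (g (average i l) j + l * z j) + g^ (suc i) (l • z) j   ≈⟨ +-congʳ (g-average i l j) ⟩
      (average i l j + g^ i (l • z) j) + g^ (suc i) (l • z) j  ∎

    g-average-fixed : ∀ l → g (average n l) ≋ average n l
    g-average-fixed l j = +-cancelʳ (l * z j) _ _ (begin
      g (average n l) j + l * z j        ≈⟨ g-average n l j ⟩
      average n l j + g^ n (l • z) j     ≈⟨ +-congˡ (g^-• n l z j) ⟩
      average n l j + σ^ n l * g^ n z j  ≈⟨ +-congˡ (*-cong (σ^n≈id l) (proj₂ (proj₂ fixedVector) j)) ⟩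
      average n l j + l * z j            ∎)

    -- As a function of `l`, each coordinate of the average is a q-polynomial with coefficients
    -- taken from the iterates of `z`; this makes the independence of the σ^i applicable.
    average≈combination : ∀ i l j → average i l j ≈ combination i (λ m → g^ m z j) l
    average≈combination zero l j = refl
    average≈combination (suc i) l j =
      +-cong (average≈combination i l j) (trans (g^-• i l z j) (*-comm _ _))

    absurd : ⊥
    absurd with Fin.any? (λ i → ¬? (average n (at i) V₃.≟ 𝟎))
    ... | yes (i , avg≉0) = noEigenvector avg≉0 λ j → begin
          f (average n (at i)) j               ≈⟨ *-identityˡ _ ⟨
          1# * f (average n (at i)) j          ≈⟨ *-congʳ uν≈1 ⟨
          u * ν * f (average n (at i)) j       ≈⟨ *-assoc _ _ _ ⟩
          u * g (average n (at i)) j           ≈⟨ *-congˡ (g-average-fixed (at i) j) ⟩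
          u * average n (at i) j               ∎
    -- Coefficient 0 of the vanishing q-polynomial is `z j`, so `z` would be zero.
    ... | no none = proj₁ (proj₂ fixedVector) λ j →
          σ^-independent n ℕ.≤-refl (λ m → g^ m z j) (vanish j) n≥1
      where
      vanish : ∀ j l → combination n (λ m → g^ m z j) l ≈ 0#
      vanish j l = begin
        combination n (λ m → g^ m z j) l                   ≈⟨ combination-cong n _ (at-index l) ⟨
        combination n (λ m → g^ m z j) (at (index l))      ≈⟨ average≈combination n (at (index l)) j ⟨
        average n (at (index l)) j  ≈⟨ decidable-stable (average n (at (index l)) V₃.≟ 𝟎) (none ∘ (index l ,_)) j ⟩
        0#                                                 ∎

  -- Either `f x` is a multiple of `x`, or the two span an invariant plane, the kernel of `x ⨯ f x`.
  -- The companion matrix has determinant c, so this functional turns `f` into -(c/l) times σ;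
  -- scaling `f` by -(l/c) makes it semi-invariant.
  noQuadraticRelation : ∀ {x m l} → ¬ l ≈ 0# → ¬ x ≋ 𝟎 → ¬ f (f x) ≋ m • f x ⊹ l • x
  noQuadraticRelation {x} {m} {l} l≉0 x≉0 rel with (x ⨯ f x) V₃.≟ 𝟎
  ... | yes k≋0 = noEigenvector x≉0 (proj₂ (⨯≋0⇒multiple x≉0 k≋0))
  ... | no k≉0  = SemiInvariantFunctional.absurd k k≉0 (- (l * c⁻¹)) (- (l⁻¹ * c)) uν≈1 semi
    where
    y = f x
    k = x ⨯ y
    c⁻¹ = proj₁ (inverse c c≉0)
    l⁻¹ = proj₁ (inverse l l≉0)
    uν≈1 : - (l⁻¹ * c) * - (l * c⁻¹) ≈ 1#
    uν≈1 = begin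
      - (l⁻¹ * c) * - (l * c⁻¹)
        ≈⟨ solve 4 (λ i c l j → (:- (i :* c)) :* (:- (l :* j)) := (l :* i) :* (c :* j)) refl _ _ _ _ ⟩
      (l * l⁻¹) * (c * c⁻¹)   ≈⟨ *-cong (proj₂ (inverse l l≉0)) (proj₂ (inverse c c≉0)) ⟩
      1# * 1#                 ≈⟨ *-identityˡ 1# ⟩
      1#                      ∎
    -- From f y = m y + l x, the product `y ⨯ f y` is -l k. It is also the cross product of `f x`
    -- and `f y`, hence the cofactor matrix of the companion matrix applied to σ k. These are its
    -- three coordinates; `semi` follows since transposed cofactors times the matrix give the
    -- determinant c.
    lk₀ : - (l * k 0F) ≈ σ (k 2F) - σ (k 0F)
    lk₀ = begin
      - (l * k 0F)
        ≈⟨ solve 6 (λ m l x₁ x₂ y₁ y₂ → :- (l :* (x₁ :* y₂ :- x₂ :* y₁))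
             := y₁ :* (m :* y₂ :+ l :* x₂) :- y₂ :* (m :* y₁ :+ l :* x₁)) refl m l (x 1F) (x 2F) (y 1F) (y 2F) ⟩
      y 1F * (m * y 2F + l * x 2F) - y 2F * (m * y 1F + l * x 1F)
        ≈⟨ +-cong (*-congˡ (rel 2F)) (-‿cong (*-congˡ (rel 1F))) ⟨
      (σ (x 0F) + σ (x 2F)) * σ (y 1F) - σ (x 1F) * (σ (y 0F) + σ (y 2F))
        ≈⟨ solve 6 (λ x₀ x₁ x₂ y₀ y₁ y₂ → (x₀ :+ x₂) :* y₁ :- x₁ :* (y₀ :+ y₂)
             := (x₀ :* y₁ :- x₁ :* y₀) :- (x₁ :* y₂ :- x₂ :* y₁)) refl
             (σ (x 0F)) (σ (x 1F)) (σ (x 2F)) (σ (y 0F)) (σ (y 1F)) (σ (y 2F)) ⟩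
      (σ (x 0F) * σ (y 1F) - σ (x 1F) * σ (y 0F)) - (σ (x 1F) * σ (y 2F) - σ (x 2F) * σ (y 1F))
        ≈⟨ +-cong (σ-minor _ _ _ _) (-‿cong (σ-minor _ _ _ _)) ⟨
      σ (k 2F) - σ (k 0F)  ∎
    lk₁ : - (l * k 1F) ≈ c * σ (k 0F)
    lk₁ = begin
      - (l * k 1F)
        ≈⟨ solve 6 (λ m l x₁ x₂ y₁ y₂ → :- (l :* (x₁ :* y₂ :- x₂ :* y₁))
             := y₁ :* (m :* y₂ :+ l :* x₂) :- y₂ :* (m :* y₁ :+ l :* x₁)) refl m l (x 2F) (x 0F) (y 2F) (y 0F) ⟩
      y 2F * (m * y 0F + l * x 0F) - y 0F * (m * y 2F + l * x 2F)
        ≈⟨ +-cong (*-congˡ (rel 0F)) (-‿cong (*-congˡ (rel 2F))) ⟨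
      σ (x 1F) * (c * σ (y 2F)) - c * σ (x 2F) * σ (y 1F)
        ≈⟨ solve 5 (λ c x₁ x₂ y₁ y₂ → x₁ :* (c :* y₂) :- c :* x₂ :* y₁ := c :* (x₁ :* y₂ :- x₂ :* y₁)) refl
             c (σ (x 1F)) (σ (x 2F)) (σ (y 1F)) (σ (y 2F)) ⟩
      c * (σ (x 1F) * σ (y 2F) - σ (x 2F) * σ (y 1F))   ≈⟨ *-congˡ (σ-minor _ _ _ _) ⟨
      c * σ (k 0F)  ∎
    lk₂ : - (l * k 2F) ≈ c * σ (k 1F)
    lk₂ = begin
      - (l * k 2F)
        ≈⟨ solve 6 (λ m l x₁ x₂ y₁ y₂ → :- (l :* (x₁ :* y₂ :- x₂ :* y₁))
             := y₁ :* (m :* y₂ :+ l :* x₂) :- y₂ :* (m :* y₁ :+ l :* x₁)) refl m l (x 0F) (x 1F) (y 0F) (y 1F) ⟩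
      y 0F * (m * y 1F + l * x 1F) - y 1F * (m * y 0F + l * x 0F)
        ≈⟨ +-cong (*-congˡ (rel 1F)) (-‿cong (*-congˡ (rel 0F))) ⟨
      c * σ (x 2F) * (σ (y 0F) + σ (y 2F)) - (σ (x 0F) + σ (x 2F)) * (c * σ (y 2F))
        ≈⟨ solve 5 (λ c x₀ x₂ y₀ y₂ → c :* x₂ :* (y₀ :+ y₂) :- (x₀ :+ x₂) :* (c :* y₂)
             := c :* (x₂ :* y₀ :- x₀ :* y₂)) refl c (σ (x 0F)) (σ (x 2F)) (σ (y 0F)) (σ (y 2F)) ⟩
      c * (σ (x 2F) * σ (y 0F) - σ (x 0F) * σ (y 2F))   ≈⟨ *-congˡ (σ-minor _ _ _ _) ⟨
      c * σ (k 1F)  ∎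
    semi : ∀ v → k ∙ (- (l * c⁻¹) • f v) ≈ σ (k ∙ v)
    semi v = begin
      k ∙ (- (l * c⁻¹) • f v)
        ≈⟨ solve 9 (λ l i c k₀ k₁ k₂ v₀ v₁ v₂ →
             k₀ :* ((:- (l :* i)) :* (c :* v₂)) :+ k₁ :* ((:- (l :* i)) :* (v₀ :+ v₂)) :+ k₂ :* ((:- (l :* i)) :* v₁)
             := i :* ((:- (l :* k₀)) :* (c :* v₂) :+ (:- (l :* k₁)) :* (v₀ :+ v₂) :+ (:- (l :* k₂)) :* v₁)) refl
             l c⁻¹ c (k 0F) (k 1F) (k 2F) (σ (v 0F)) (σ (v 1F)) (σ (v 2F)) ⟩
      c⁻¹ * (- (l * k 0F) * (c * σ (v 2F)) + - (l * k 1F) * (σ (v 0F) + σ (v 2F)) + - (l * k 2F) * σ (v 1F))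
        ≈⟨ *-congˡ (+-cong (+-cong (*-congʳ lk₀) (*-congʳ lk₁)) (*-congʳ lk₂)) ⟩
      c⁻¹ * ((σ (k 2F) - σ (k 0F)) * (c * σ (v 2F)) + c * σ (k 0F) * (σ (v 0F) + σ (v 2F)) + c * σ (k 1F) * σ (v 1F))
        ≈⟨ solve 8 (λ i c k₀ k₁ k₂ v₀ v₁ v₂ →
             i :* ((k₂ :- k₀) :* (c :* v₂) :+ c :* k₀ :* (v₀ :+ v₂) :+ c :* k₁ :* v₁)
             := c :* i :* (k₀ :* v₀ :+ k₁ :* v₁ :+ k₂ :* v₂)) refl
             c⁻¹ c (σ (k 0F)) (σ (k 1F)) (σ (k 2F)) (σ (v 0F)) (σ (v 1F)) (σ (v 2F)) ⟩
      c * c⁻¹ * (σ (k 0F) * σ (v 0F) + σ (k 1F) * σ (v 1F) + σ (k 2F) * σ (v 2F))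
        ≈⟨ trans (*-congʳ (proj₂ (inverse c c≉0))) (*-identityˡ _) ⟩
      σ (k 0F) * σ (v 0F) + σ (k 1F) * σ (v 1F) + σ (k 2F) * σ (v 2F)
        ≈⟨ trans (σ-+ _ _) (+-cong (trans (σ-+ _ _) (+-cong (σ-* _ _) (σ-* _ _))) (σ-* _ _)) ⟨
      σ (k ∙ v)  ∎

  -- The last two hypotheses are the two L-coordinates of ω y + f y = (α + β ω)(ω x + f x), with N
  -- the norm of ω. Applying `f` to the first and comparing with the second gives σ(β) f (f x) = (α
  -- - σ γ) f x - β N x. For β ≠ 0 this is an excluded quadratic relation; for β = 0 it says σ α =
  -- α.
  graphStabilizer : ∀ {x y α β γ N} → ¬ x ≋ 𝟎 → ¬ N ≈ 0# → (β ≈ 0# → γ ≈ α) →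
    y ≋ γ • x ⊹ β • f x → f y ≋ α • f x ⊹ (- (β * N)) • x → β ≈ 0# × InK E α
  graphStabilizer {x} {y} {α} {β} {γ} {N} x≉0 N≉0 γ≈α y≋ fy≋ = byCases (β ≟ 0#)
    where
    f-y : (σ γ • f x ⊹ σ β • f (f x)) ≋ (α • f x ⊹ (- (β * N)) • x)
    f-y j = trans (sym (trans (f-cong y≋ j)
      (trans (f-+ (γ • x) (β • f x) j) (+-cong (f-• γ x j) (f-• β (f x) j))))) (fy≋ j)
    byCases : Dec (β ≈ 0#) → β ≈ 0# × InK E α
    byCases (yes β≈0) = β≈0 , fixed⇒InK (*-cancelˡ (proj₂ nz) (begin
      Y * σ α                  ≈⟨ *-congˡ (σ-cong (γ≈α β≈0)) ⟨
      Y * σ γ                  ≈⟨ solve 3 (λ y g f → y :* g := g :* y :+ con (pos 0) :* f) refl Y (σ γ) (f (f x) j) ⟩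
      σ γ * Y + 0# * f (f x) j ≈⟨ +-congˡ (*-congʳ (trans (σ-cong β≈0) σ-0)) ⟨
      σ γ * Y + σ β * f (f x) j  ≈⟨ f-y j ⟩
      α * Y + - (β * N) * x j  ≈⟨ +-congˡ (*-congʳ (-‿cong (*-congʳ β≈0))) ⟩
      α * Y + - (0# * N) * x j ≈⟨ solve 4 (λ a y n x → a :* y :+ (:- (con (pos 0) :* n)) :* x := y :* a)
                                        refl α Y N (x j) ⟩
      Y * α                    ∎))
      where
      nz = nonzeroCoordinate (x≉0 ∘ f-≋0)
      j = proj₁ nz
      Y = f x j
    byCases (no β≉0) = contradiction relation (noQuadraticRelation ℓ≉0 x≉0)
      where
      σβ≉0 : ¬ σ β ≈ 0#
      σβ≉0 = β≉0 ∘ σ-≈0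
      i = proj₁ (inverse (σ β) σβ≉0)
      σβi≈1 : σ β * i ≈ 1#
      σβi≈1 = proj₂ (inverse (σ β) σβ≉0)
      i≉0 : ¬ i ≈ 0#
      i≉0 i≈0 = 0≉1 (trans (sym (zeroʳ _)) (trans (*-congˡ (sym i≈0)) σβi≈1))
      ℓ≉0 : ¬ - (i * (β * N)) ≈ 0#
      ℓ≉0 e = N≉0 (noZeroDivisors (noZeroDivisors
        (trans (sym (-‿involutive _)) (trans (-‿cong e) -0#≈0#)) i≉0) β≉0)
      relation : f (f x) ≋ (i * (α - σ γ)) • f x ⊹ (- (i * (β * N))) • x
      relation j = begin
        f (f x) j                 ≈⟨ *-identityˡ _ ⟨
        1# * f (f x) j            ≈⟨ *-congʳ σβi≈1 ⟨
        σ β * i * f (f x) j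
          ≈⟨ solve 5 (λ s i f g y → s :* i :* f := i :* ((g :* y :+ s :* f) :- g :* y))
                   refl (σ β) i (f (f x) j) (σ γ) (f x j) ⟩
        i * ((σ γ * f x j + σ β * f (f x) j) - σ γ * f x j)       ≈⟨ *-congˡ (+-congʳ (f-y j)) ⟩
        i * ((α * f x j + - (β * N) * x j) - σ γ * f x j)
          ≈⟨ solve 7 (λ i a y b n x g → i :* ((a :* y :+ (:- (b :* n)) :* x) :- g :* y)
               := (i :* (a :- g)) :* y :+ (:- (i :* (b :* n))) :* x) refl i α (f x j) β N (x j) (σ γ) ⟩
        i * (α - σ γ) * f x j + - (i * (β * N)) * x j  ∎

-- Scattered subspaces and the extraction of a basis

record ScatteredSubspace {q n : ℕ} (E : FieldExt q n) (r k : ℕ) : Set₁ where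
  open FiniteField E
  open VectorSpace E
  field
    Mem       : Vect E r → Set
    resp      : ∀ {u v} → u ≋ v → Mem u → Mem v
    0∈        : Mem 𝟎
    +∈        : ∀ {u v} → Mem u → Mem v → Mem (u ⊹ v)
    •∈        : ∀ {a v} → InK E a → Mem v → Mem (a • v)
    scattered : ∀ {a v} → Mem v → ¬ v ≋ 𝟎 → Mem (a • v) → InK E a
    -- The rank is recorded by q^k distinct vectors: such families are immediate for graphs and
    -- direct sums, and a basis is recovered from the count.
    point     : Fin (q ^ℕ k) → Vect E r
    point∈    : ∀ i → Mem (point i)
    point-inj : ∀ {i j} → point i ≋ point j → i ≡ j

module GreedyBasis {q n : ℕ} {E : FieldExt q n} {r k : ℕ} (S : ScatteredSubspace E r k) where
  open FiniteField E
  open VectorSpace E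
  open ScatteredSubspace S
  open SetoidReasoning setoid

  private module Vr = V {r}

  lincomb-cong : ∀ {m} {c d : Fin m → Fin q} (b : Fin m → Vect E r) → (∀ i → c i ≡ d i) →
                 lincomb E c b ≋ lincomb E d b
  lincomb-cong {zero} b e j = refl
  lincomb-cong {suc m} b e j =
    +-cong (*-congʳ (reflexive (≡.cong emb (e zero)))) (lincomb-cong (b ∘ suc) (e ∘ suc) j)

  lincomb-scale : ∀ {m} a {c d : Fin m → Fin q} (b : Fin m → Vect E r) → (∀ i → emb (d i) ≈ a * emb (c i)) →
                  lincomb E d b ≋ a • lincomb E c b
  lincomb-scale {zero} a b e j = sym (zeroʳ a)
  lincomb-scale {suc m} a b e j = trans
    (+-cong (trans (*-congʳ (e zero)) (*-assoc _ _ _)) (lincomb-scale a (b ∘ suc) (e ∘ suc) j))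
    (sym (distribˡ _ _ _))

  lincomb∈ : ∀ {m} c {b : Fin m → Vect E r} → (∀ i → Mem (b i)) → Mem (lincomb E c b)
  lincomb∈ {zero} c b∈ = resp (λ _ → refl) 0∈
  lincomb∈ {suc m} c b∈ =
    resp (λ _ → refl) (+∈ (•∈ (c zero , refl) (b∈ zero)) (lincomb∈ (c ∘ suc) (b∈ ∘ suc)))

  inSpan? : ∀ {m} (b : Fin m → Vect E r) v → Dec (InSpan E b v)
  inSpan? b v = map′ (λ { (i , e) → finToFun i , e })
    (λ { (c , e) → funToFin c , Vr.trans (lincomb-cong b (Fin.finToFun-funToFin c)) e })
    (Fin.any? λ i → lincomb E (finToFun i) b Vr.≟ v)

  -- The K-span of m vectors has at most q^m < q^k elements.
  outsideSpan : ∀ {m} → m < k → (b : Fin m → Vect E r) → ∃ λ i → ¬ InSpan E b (point i)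
  outsideSpan {m} m<k b with Fin.all? (λ i → inSpan? b (point i))
  ... | no ¬all = Fin.¬∀⟶∃¬ _ _ (λ i → inSpan? b (point i)) ¬all
  ... | yes all = contradiction (Fin.injective⇒≤ {f = code} code-inj) (ℕ.<⇒≱ (ℕ.^-monoʳ-< q 1<q m<k))
    where
    code : Fin (q ^ℕ k) → Fin (q ^ℕ m)
    code i = funToFin (proj₁ (all i))
    code-inj : ∀ {i j} → code i ≡ code j → i ≡ j
    code-inj {i} {j} e = point-inj (Vr.trans (Vr.sym (proj₂ (all i)))
      (Vr.trans (lincomb-cong b same) (proj₂ (all j))))
      where
      same : ∀ l → proj₁ (all i) l ≡ proj₁ (all j) l
      same l = ≡.trans (≡.sym (Fin.finToFun-funToFin (proj₁ (all i)) l))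
        (≡.trans (≡.cong (λ t → finToFun t l) e) (Fin.finToFun-funToFin (proj₁ (all j)) l))

  extend : ∀ {m} → Vect E r → (Fin m → Vect E r) → Fin (suc m) → Vect E r
  extend v b zero    = v
  extend v b (suc i) = b i

  extend-independent : ∀ {m} {b : Fin m → Vect E r} {v} → ¬ InSpan E b v → KIndependent E b →
                       KIndependent E (extend v b)
  extend-independent {m} {b} {v} v∉ indep c rel with emb (c zero) ≟ 0#
  ... | yes c₀≈0 = λ { zero → c₀≈0 ; (suc i) → indep (c ∘ suc) rest i }
    where
    rest : lincomb E (c ∘ suc) b ≋ 𝟎
    rest j = begin
      lincomb E (c ∘ suc) b j                       ≈⟨ +-identityˡ _ ⟨
      0# + lincomb E (c ∘ suc) b j                  ≈⟨ +-congʳ (trans (*-congʳ c₀≈0) (zeroˡ _)) ⟨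
      emb (c zero) * v j + lincomb E (c ∘ suc) b j  ≈⟨ rel j ⟩
      0#                                            ∎
  ... | no c₀≉0 = contradiction (proj₁ ∘ scaledIndex , inSpan) v∉
    where
    c₀ = emb (c zero)
    a = proj₁ (inverse c₀ c₀≉0)
    c₀a≈1 : c₀ * a ≈ 1#
    c₀a≈1 = proj₂ (inverse c₀ c₀≉0)
    -- The inverse of c₀ is taken in F; being fixed by σ is what brings the new coefficients back
    -- into K.
    σa≈a : σ a ≈ a
    σa≈a = *-cancelˡ c₀≉0 (begin
      c₀ * σ a     ≈⟨ *-congʳ (σ-emb (c zero)) ⟨
      σ c₀ * σ a   ≈⟨ σ-* c₀ a ⟨
      σ (c₀ * a)   ≈⟨ trans (σ-cong c₀a≈1) σ-1 ⟩
      1#           ≈⟨ c₀a≈1 ⟨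
      c₀ * a       ∎)
    scaledIndex : ∀ i → InK E (- a * emb (c (suc i)))
    scaledIndex i = fixed⇒InK (trans (σ-* _ _) (*-cong (trans (σ-neg a) (-‿cong σa≈a)) (σ-emb _)))
    inSpan : lincomb E (proj₁ ∘ scaledIndex) b ≋ v
    inSpan j = begin
      lincomb E (proj₁ ∘ scaledIndex) b j   ≈⟨ lincomb-scale (- a) b (proj₂ ∘ scaledIndex) j ⟩
      - a * lc                              ≈⟨ solve 4 (λ a l c v → (:- a) :* l := c :* a :* v :- a :* (c :* v :+ l))
                                                     refl a lc c₀ (v j) ⟩
      c₀ * a * v j - a * (c₀ * v j + lc)    ≈⟨ +-cong (*-congʳ c₀a≈1) (-‿cong (*-congˡ (rel j))) ⟩
      1# * v j - a * 0#                     ≈⟨ solve 2 (λ a v → con (pos 1) :* v :- a :* con (pos 0) := v) refl a (v j) ⟩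
      v j                                   ∎
      where lc = lincomb E (c ∘ suc) b j

  independentFamily : ∀ m → m ≤ k →
    Σ (Fin m → Vect E r) λ b → (∀ i → Mem (b i)) × KIndependent E b
  independentFamily zero _ = (λ ()) , (λ ()) , λ _ _ ()
  independentFamily (suc m) m<k =
    let b , b∈ , indep = independentFamily m (ℕ.<⇒≤ m<k)
        i , v∉ = outsideSpan m<k b
    in extend (point i) b , (λ { zero → point∈ i ; (suc l) → b∈ l }) , extend-independent v∉ indep

  -- The span stays inside the subspace by closure, and a subspace of a scattered subspace is
  -- scattered.
  existsScattered : ExistsScatteredLinearSet E r k
  existsScattered =
    let b , b∈ , indep = independentFamily k ℕ.≤-refl
        span∈ = λ {v} (s : InSpan E b v) → resp (proj₂ s) (lincomb∈ (proj₁ s) b∈)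
    in b , indep , λ u u∈ u≉0 a au∈ → scattered (span∈ u∈) u≉0 (span∈ au∈)

-- Direct sums with the graph of σ

emptySubspace : ∀ {q n} (E : FieldExt q n) → ScatteredSubspace E 0 0
emptySubspace E = record
  { Mem = λ _ → ⊤ ; resp = λ _ _ → tt ; 0∈ = tt ; +∈ = λ _ _ → tt ; •∈ = λ _ _ → tt
  ; scattered = λ _ v≉0 _ → contradiction (λ ()) v≉0
  ; point = λ _ () ; point∈ = λ _ → tt ; point-inj = λ { {zero} {zero} _ → ≡.refl } }

-- The direct sum with {(x, x^q)}, which is scattered since a x^q = (a x)^q and x ≠ 0 force a^q = a.
module AddPseudoregulus {q n : ℕ} {E : FieldExt q n} {r k : ℕ} (S : ScatteredSubspace E r k) where
  open FiniteField E
  open VectorSpace E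
  open SetoidReasoning setoid
  private module S = ScatteredSubspace S

  rest : Vect E (2 ℕ.+ r) → Vect E r
  rest v j = v (suc (suc j))

  Mem : Vect E (2 ℕ.+ r) → Set
  Mem v = v 1F ≈ σ (v 0F) × S.Mem (rest v)

  -- A nonzero vector has a nonzero component in one of the two summands, and that component alone
  -- forces `a` into K.
  scattered : ∀ {a v} → Mem v → ¬ v ≋ 𝟎 → Mem (a • v) → InK E a
  scattered {a} {v} (v₁≈σv₀ , rest∈) v≉0 (av₁≈σav₀ , arest∈) with v 0F ≟ 0#
  ... | no v₀≉0 = fixed⇒InK (*-cancelˡ (v₀≉0 ∘ σ-≈0) (begin
    σ (v 0F) * σ a    ≈⟨ *-comm _ _ ⟩
    σ a * σ (v 0F)    ≈⟨ σ-* a (v 0F) ⟨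
    σ (a * v 0F)      ≈⟨ av₁≈σav₀ ⟨
    a * v 1F          ≈⟨ *-congˡ v₁≈σv₀ ⟩
    a * σ (v 0F)      ≈⟨ *-comm _ _ ⟩
    σ (v 0F) * a      ∎))
  ... | yes v₀≈0 = S.scattered rest∈ rest≉0 arest∈
    where
    rest≉0 : ¬ rest v ≋ 𝟎
    rest≉0 e = v≉0 λ { zero → v₀≈0 ; 1F → trans v₁≈σv₀ (trans (σ-cong v₀≈0) σ-0) ; (suc (suc j)) → e j }

  parts : Fin (q ^ℕ (n ℕ.+ k)) → Fin (q ^ℕ n) × Fin (q ^ℕ k)
  parts i = remQuot (q ^ℕ k) (Fin.cast (ℕ.^-distribˡ-+-* q n k) i)

  parts-injective : ∀ {i j} → parts i ≡ parts j → i ≡ j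
  parts-injective {i} {j} e = cast-injective (ℕ.^-distribˡ-+-* q n k)
    (≡.trans (≡.sym (Fin.combine-remQuot {q ^ℕ n} (q ^ℕ k) _))
      (≡.trans (≡.cong (uncurry combine) e) (Fin.combine-remQuot {q ^ℕ n} (q ^ℕ k) _)))

  point : Fin (q ^ℕ (n ℕ.+ k)) → Vect E (2 ℕ.+ r)
  point i zero          = at (proj₁ (parts i))
  point i 1F            = σ (at (proj₁ (parts i)))
  point i (suc (suc j)) = S.point (proj₂ (parts i)) j

  sum : ScatteredSubspace E (2 ℕ.+ r) (n ℕ.+ k)
  sum = record
    { Mem = Mem
    ; resp = λ e (e₁ , m) → trans (sym (e 1F)) (trans e₁ (σ-cong (e 0F))) , S.resp (λ j → e (suc (suc j))) m
    ; 0∈ = sym σ-0 , S.resp (λ _ → refl) S.0∈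
    ; +∈ = λ (e , m) (e′ , m′) → trans (+-cong e e′) (sym (σ-+ _ _)) , S.resp (λ _ → refl) (S.+∈ m m′)
    ; •∈ = λ a∈K (e , m) → trans (*-cong (sym (InK⇒fixed a∈K)) e) (sym (σ-* _ _)) ,
             S.resp (λ _ → refl) (S.•∈ a∈K m)
    ; scattered = λ {a} {v} → scattered {a} {v}
    ; point = point
    ; point∈ = λ i → refl , S.resp (λ _ → refl) (S.point∈ (proj₂ (parts i)))
    ; point-inj = λ {i} {j} e → parts-injective
        (≡.cong₂ _,_ (at-injective (e 0F)) (S.point-inj (λ j → e (suc (suc j))))) }

-- The scattered subspace of rank 3s in F³

-- U = {ω x + f x : x ∈ L³} for a basis {1, ω} of F over L: if (α + β ω)(ω x + f x) ∈ U with β ≠ 0, then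
-- f (f x) is an L-combination of f x and x in which the coefficient of x is nonzero.
module PlaneSubspace {q n s : ℕ} (E : FieldExt q n) (n≡s+s : n ≡ s ℕ.+ s) (s≥1 : s ≥ 1) where
  open FiniteField E
  open VectorSpace E
  open QuadraticSubfield E n≡s+s s≥1
  open SetoidReasoning setoid
  private
    module L  = FiniteField subfield
    module LV = VectorSpace subfield
    module L₃ = LV.V {3}
  open CompanionMap subfield s≥1 using (f; f-cong; f-+; f-•; f-0; graphStabilizer)

  s<n : s < n
  s<n = ≡.subst (s <_) (≡.sym n≡s+s) (ℕ.m<m+n s s≥1)

  outside : ∃ λ i → ¬ InL (at i)
  outside = Fin.¬∀⟶∃¬ _ _ (λ i → conj (at i) ≟ at i) λ all →
    ℕ.<⇒≱ (ℕ.^-monoʳ-< q 1<q s<n)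
      (Fin.injective⇒≤ {f = λ i → L.index (at i , all i)} (λ e → at-injective (L.index-injective e)))

  abstract
    ω : Carrier
    ω = at (proj₁ outside)

    ω∉L : ¬ InL ω
    ω∉L = proj₂ outside

  ω̄ δ : Carrier
  ω̄ = conj ω
  δ = ω - ω̄

  δ≉0 : ¬ δ ≈ 0#
  δ≉0 e = ω∉L (sym (x-y≈0⇒x≈y e))

  ω≉0 : ¬ ω ≈ 0#
  ω≉0 e = ω∉L (trans (σ^-cong s e) (trans L-0 (sym e)))

  ω̄≉0 : ¬ ω̄ ≈ 0#
  ω̄≉0 e = ω≉0 (trans (sym (conj-conj ω)) (trans (σ^-cong s e) L-0))

  -- Conjugation fixes L and sends ω to ω̄; subtracting the conjugate equation leaves (ω - ω̄) a =
  -- (ω - ω̄) a′.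
  ω-coordinates : ∀ {a b a′ b′} → InL a → InL b → InL a′ → InL b′ →
                  ω * a + b ≈ ω * a′ + b′ → a ≈ a′ × b ≈ b′
  ω-coordinates {a} {b} {a′} {b′} ha hb ha′ hb′ e = a≈a′ , +-cancelˡ (ω * a) b b′
    (trans e (+-congʳ (*-congˡ (sym a≈a′))))
    where
    conjugate : ∀ {a b} → InL a → InL b → conj (ω * a + b) ≈ ω̄ * a + b
    conjugate ha hb = trans (σ^-+ s _ _) (+-cong (trans (σ^-* s _ _) (*-congˡ ha)) hb)
    a≈a′ : a ≈ a′
    a≈a′ = *-cancelˡ δ≉0 (begin
      (ω - ω̄) * a                        ≈⟨ solve 4 (λ w v a b → (w :- v) :* a := (w :* a :+ b) :- (v :* a :+ b))
                                                  refl ω ω̄ a b ⟩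
      (ω * a + b) - (ω̄ * a + b)          ≈⟨ +-cong e (-‿cong (trans (sym (conjugate ha hb))
                                              (trans (σ^-cong s e) (conjugate ha′ hb′)))) ⟩
      (ω * a′ + b′) - (ω̄ * a′ + b′)      ≈⟨ solve 4 (λ w v a b → (w :- v) :* a := (w :* a :+ b) :- (v :* a :+ b))
                                                  refl ω ω̄ a′ b′ ⟨
      (ω - ω̄) * a′                       ∎)

  -- β = (λ - λ̄) / (ω - ω̄) for λ = α + β ω.
  decompose : ∀ a → ∃ λ (α : L.Carrier) → ∃ λ (β : L.Carrier) → a ≈ proj₁ α + proj₁ β * ω
  decompose a = (α , α∈L) , (β , β∈L) , solve 2 (λ a m → a := (a :- m) :+ m) refl a (β * ω)
    where
    δ⁻¹ = proj₁ (inverse δ δ≉0)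
    β = (a - conj a) * δ⁻¹
    α = a - β * ω
    conj-minus : ∀ x y → conj (x - y) ≈ conj x - conj y
    conj-minus x y = trans (σ^-+ s x (- y)) (+-congˡ (σ^-neg s y))
    δβ≈ : δ * β ≈ a - conj a
    δβ≈ = begin
      δ * ((a - conj a) * δ⁻¹)  ≈⟨ solve 3 (λ d x i → d :* (x :* i) := x :* (d :* i)) refl _ _ _ ⟩
      (a - conj a) * (δ * δ⁻¹)  ≈⟨ trans (*-congˡ (proj₂ (inverse δ δ≉0))) (*-identityʳ _) ⟩
      a - conj a                ∎
    β∈L : InL β
    β∈L = *-cancelˡ δ≉0 (begin
      δ * conj β             ≈⟨ solve 3 (λ w v b → (w :- v) :* b := :- ((v :- w) :* b)) refl ω ω̄ (conj β) ⟩
      - ((ω̄ - ω) * conj β)   ≈⟨ -‿cong (*-congʳ (+-congˡ (-‿cong (conj-conj ω)))) ⟨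
      - ((ω̄ - conj ω̄) * conj β)  ≈⟨ -‿cong (trans (σ^-* s δ β) (*-congʳ (conj-minus ω ω̄))) ⟨
      - conj (δ * β)         ≈⟨ -‿cong (trans (σ^-cong s δβ≈) (conj-minus a (conj a))) ⟩
      - (conj a - conj (conj a))  ≈⟨ -‿cong (+-congˡ (-‿cong (conj-conj a))) ⟩
      - (conj a - a)         ≈⟨ solve 2 (λ a b → :- (b :- a) := a :- b) refl a (conj a) ⟩
      a - conj a             ≈⟨ δβ≈ ⟨
      δ * β                  ∎)
    α∈L : InL α
    α∈L = begin
      conj (a - β * ω)           ≈⟨ conj-minus a (β * ω) ⟩
      conj a - conj (β * ω)      ≈⟨ +-congˡ (-‿cong (trans (σ^-* s β ω) (*-congʳ β∈L))) ⟩
      conj a - β * ω̄             ≈⟨ solve 4 (λ c b w v → c :- b :* v := (c :+ (w :- v) :* b) :- b :* w)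
                                          refl (conj a) β ω ω̄ ⟩
      (conj a + δ * β) - β * ω   ≈⟨ +-congʳ (trans (+-congˡ δβ≈)
                                      (solve 2 (λ a c → c :+ (a :- c) := a) refl a (conj a))) ⟩
      a - β * ω                  ∎

  -- The coefficients in ω² = trace ω - norm, by which products with ω are rewritten in the basis 1,
  -- ω. Conjugation exchanges ω and ω̄, so both lie in L.
  trace norm : L.Carrier
  trace = ω + ω̄ , trans (σ^-+ s ω ω̄) (trans (+-congˡ (conj-conj ω)) (+-comm _ _))
  norm  = ω * ω̄ , trans (σ^-* s ω ω̄) (trans (*-congˡ (conj-conj ω)) (*-comm _ _))

  norm≉0 : ¬ ω * ω̄ ≈ 0#
  norm≉0 e = ω̄≉0 (noZeroDivisors e ω≉0)

  combine-ω : Vect subfield 3 → Vect subfield 3 → Vect E 3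
  combine-ω x y j = ω * proj₁ (x j) + proj₁ (y j)

  combine-ω-injective : ∀ {x y x′ y′} → combine-ω x y ≋ combine-ω x′ y′ → (x LV.≋ x′) × (y LV.≋ y′)
  combine-ω-injective {x} {y} {x′} {y′} e = (λ j → proj₁ (coords j)) , (λ j → proj₂ (coords j))
    where
    coords : ∀ j → proj₁ (x j) ≈ proj₁ (x′ j) × proj₁ (y j) ≈ proj₁ (y′ j)
    coords j = ω-coordinates (proj₂ (x j)) (proj₂ (y j)) (proj₂ (x′ j)) (proj₂ (y′ j)) (e j)

  graph : Vect subfield 3 → Vect E 3
  graph x = combine-ω x (f x)

  graph-0 : graph LV.𝟎 ≋ 𝟎
  graph-0 j = trans (+-cong (zeroʳ ω) (f-0 j)) (+-identityʳ 0#)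

  graph-injective : ∀ {x y} → graph x ≋ graph y → x LV.≋ y
  graph-injective {x} {y} e = proj₁ (combine-ω-injective {x} {f x} {y} {f y} e)

  Mem : Vect E 3 → Set
  Mem v = ∃ λ x → graph x ≋ v

  scattered-graph : ∀ {α β : L.Carrier} {x y} → ¬ x LV.≋ LV.𝟎 →
                    graph y ≋ (proj₁ α + proj₁ β * ω) • graph x → proj₁ β ≈ 0# × InK E (proj₁ α)
  scattered-graph {α} {β} {x} {y} x≉0 e = graphStabilizer {x} {y} {α} {β} {γ} {norm} x≉0 norm≉0 γ≈α
    (proj₁ coords) (proj₂ coords)
    where
    γ : L.Carrier
    γ = α L.+ β L.* trace
    γ≈α : proj₁ β ≈ 0# → proj₁ γ ≈ proj₁ α
    γ≈α β≈0 = trans (+-congˡ (trans (*-congʳ β≈0) (zeroˡ _))) (+-identityʳ _)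
    expand : graph y ≋ combine-ω (γ LV.• x LV.⊹ β LV.• f x) (α LV.• f x LV.⊹ (L.- (β L.* norm)) LV.• x)
    expand j = trans (e j) (solve 6 (λ a b w v x y →
      (a :+ b :* w) :* (w :* x :+ y)
      := w :* ((a :+ b :* (w :+ v)) :* x :+ b :* y) :+ (a :* y :+ (:- (b :* (w :* v))) :* x)) refl
      (proj₁ α) (proj₁ β) ω ω̄ (proj₁ (x j)) (proj₁ (f x j)))
    coords = combine-ω-injective {y} {f y} {γ LV.• x LV.⊹ β LV.• f x}
                                 {α LV.• f x LV.⊹ (L.- (β L.* norm)) LV.• x} expand

  scattered : ∀ {a v} → Mem v → ¬ v ≋ 𝟎 → Mem (a • v) → InK E a
  scattered {a} {v} (x , gx≋v) v≉0 (y , gy≋av) = conclude (decompose a)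
    where
    x≉0 : ¬ x LV.≋ LV.𝟎
    x≉0 x≋0 = v≉0 λ j → begin
      v j              ≈⟨ gx≋v j ⟨
      graph x j        ≈⟨ +-cong (*-congˡ (x≋0 j)) (f-cong {x} {LV.𝟎} x≋0 j) ⟩
      graph LV.𝟎 j     ≈⟨ graph-0 j ⟩
      0#               ∎
    conclude : (∃ λ (α : L.Carrier) → ∃ λ (β : L.Carrier) → a ≈ proj₁ α + proj₁ β * ω) → InK E a
    conclude (α , β , a≈α+βω) = proj₁ (proj₂ stable) , (begin
      emb (proj₁ (proj₂ stable))    ≈⟨ proj₂ (proj₂ stable) ⟩
      proj₁ α                       ≈⟨ +-identityʳ _ ⟨
      proj₁ α + 0#                  ≈⟨ +-congˡ (trans (*-congʳ (proj₁ stable)) (zeroˡ ω)) ⟨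
      proj₁ α + proj₁ β * ω         ≈⟨ a≈α+βω ⟨
      a                             ∎)
      where
      stable : proj₁ β ≈ 0# × InK E (proj₁ α)
      stable = scattered-graph {α} {β} {x} {y} x≉0
        (λ j → trans (gy≋av j) (*-cong a≈α+βω (sym (gx≋v j))))

  points≡ : q ^ℕ (3 ℕ.* s) ≡ (q ^ℕ s) ^ℕ 3
  points≡ = ≡.trans (≡.cong (q ^ℕ_) (ℕ.*-comm 3 s)) (≡.sym (ℕ.^-*-assoc q s 3))

  plane : ScatteredSubspace E 3 (3 ℕ.* s)
  plane = record
    { Mem = Mem
    ; resp = λ e (x , h) → x , λ j → trans (h j) (e j)
    ; 0∈ = LV.𝟎 , graph-0
    ; +∈ = λ (x , h) (y , h′) → x LV.⊹ y , λ j → trans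
        (trans (+-cong (distribˡ ω _ _) (f-+ x y j))
               (solve 4 (λ a b c d → (a :+ b) :+ (c :+ d) := (a :+ c) :+ (b :+ d)) refl _ _ _ _))
        (+-cong (h j) (h′ j))
    ; •∈ = λ { {a} {v} (i , embi≈a) (x , h) →
        let κ = FieldExt.emb subfield i in
        κ LV.• x , λ j → trans
          (+-congˡ (trans (f-• κ x j) (*-congʳ (L.σ-emb i))))
          (trans (solve 4 (λ k w x y → w :* (k :* x) :+ k :* y := k :* (w :* x :+ y))
                        refl (emb i) ω (proj₁ (x j)) (proj₁ (f x j)))
                 (*-cong embi≈a (h j))) }
    ; scattered = scattered
    ; point = λ i → graph (L₃.at (Fin.cast points≡ i))
    ; point∈ = λ i → L₃.at (Fin.cast points≡ i) , λ _ → refl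
    ; point-inj = λ e → cast-injective points≡ (L₃.at-injective (graph-injective e)) }

-- For r = 1 all nonzero vectors represent a single point, which would have weight s. The descent by
-- 2, each step accounting for rank 2s, therefore ends at r = 3 when r is odd.
scatteredSubspace : ∀ {q s} → s ≥ 1 → (E : FieldExt q (2 ℕ.* s)) → ∀ r → r ≢ 1 → ScatteredSubspace E r (r ℕ.* s)
scatteredSubspace s≥1 E 0 _ = emptySubspace E
scatteredSubspace s≥1 E 1 r≢1 = contradiction ≡.refl r≢1
scatteredSubspace {s = s} s≥1 E (suc (suc r)) _ with r ℕ.≟ 1
... | yes ≡.refl = PlaneSubspace.plane E (≡.cong (s ℕ.+_) (ℕ.+-identityʳ s)) s≥1
... | no r≢1 = ≡.subst (ScatteredSubspace E (2 ℕ.+ r)) (≡.sym (ℕ.*-distribʳ-+ s 2 r))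
  (AddPseudoregulus.sum (scatteredSubspace s≥1 E r r≢1))

open import Data.Nat using (_*_)

theorem1p2 : (q t s r : ℕ) → IsPrimePower q → t ≡ 2 * s → s ≥ 1 → r ≥ 2 →
    ((q ≡ 2 × t ≥ 4) ⊎ (t % 3 ≢ 0) ⊎ (q % 3 ≡ 1 × t % 3 ≡ 0)) →
    (E : FieldExt q t) → ExistsScatteredLinearSet E r (r * s)
theorem1p2 q t s r _ ≡.refl s≥1 r≥2 _ E =
  GreedyBasis.existsScattered (scatteredSubspace s≥1 E r (λ { ≡.refl → ℕ.<-irrefl ≡.refl r≥2 }))
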